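{- Let $s \geq 3$ and $k \geq 2$ be integers and let $q$ be a prime power. For a positive integer $m$ write $[m]_q = \frac{q^m-1}{q-1}$. (Upper bound.) Let $n$ be a positive integer and let $\mathcal{F}$ be a family of $k$-dimensional subspaces of $V(n,q) = \mathbb{F}_q^n$ that contains no $s$-sunflower. Then \[ |\mathcal{F}| \le \prod_{i=1}^{k} [i(s-1)]_q \le \Big(\frac{q}{q-1}\Big)^k q^{(s-1)\binom{k+1}{2}-k}. \] (Lower bounds.) There exist a positive integer $n$ and a family $\mathcal{F}$ of $k$-dimensional subspaces of $V(n,q)$ containing no $s$-sunflower such that: \begin{enumerate} \item if $s \geq k+1$, then $|\mathcal{F}| \geq q^{(s-1)\binom{k+1}{2}-k}$; \item if $s \leq k$, then $|\mathcal{F}| \geq q^{(s-2)\binom{k+1}{2} + k\frac{\gcd(k,s-1)-3}{2}} \geq q^{(s-2)\binom{k+1}{2}-k}$. \end{enumerate}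
   Context: $V(n,q)$ denotes the $n$-dimensional vector space over the finite field $\mathbb{F}_q$; a $k$-space means a $k$-dimensional subspace. A family of subspaces is a set (not a multiset). A collection of $s$ distinct $k$-spaces $S_1,\ldots,S_s$ is an $s$-sunflower with kernel $K$ if there is a $d$-dimensional subspace $K$ with $K = S_i \cap S_j$ for all distinct $i,j$ and the quotients $S_1/K,\ldots,S_s/K$ are in general position, i.e. $\dim(S_1+\cdots+S_s) = d + s(k-d)$. A family is $s$-sunflower-free if it contains no $s$-sunflower. -}

module Defs where

open import Level using (0ℓ)
open import Data.Nat using (ℕ; zero; suc; _+_; _*_; _∸_; _^_; _≤_; _≥_)
open import Data.Nat.Primality using (Prime)
open import Data.Fin using (Fin; zero; suc)
open import Data.Vec using (Vec; zipWith; map; replicate)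
open import Data.Product using (Σ; ∃; ∃-syntax; _×_)
open import Relation.Binary.PropositionalEquality using (_≡_; _≢_)
open import Relation.Nullary using (¬_)
open import Algebra.Structures using (IsCommutativeRing)
open import Function.Bundles using (_↔_)

IsPrimePower : ℕ → Set
IsPrimePower q = ∃[ p ] ∃[ m ] (Prime p × m ≥ 1 × q ≡ p ^ m)

record FiniteField (q : ℕ) : Set₁ where
  infixl 7 _*ᶠ_
  infixl 6 _+ᶠ_
  field
    Carrier           : Set
    _+ᶠ_              : Carrier → Carrier → Carrier
    _*ᶠ_              : Carrier → Carrier → Carrier
    -ᶠ_               : Carrier → Carrier
    0#                : Carrier
    1#                : Carrier
    isCommutativeRing : IsCommutativeRing _≡_ _+ᶠ_ _*ᶠ_ -ᶠ_ 0# 1#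
    0≢1               : 0# ≢ 1#
    inverse           : ∀ x → x ≢ 0# → ∃[ y ] (x *ᶠ y ≡ 1#)
    cardinality       : Carrier ↔ Fin q

module _ {q : ℕ} (𝔽 : FiniteField q) where
  open FiniteField 𝔽

  V : ℕ → Set
  V n = Vec Carrier n

  Pred : ℕ → Set₁
  Pred n = V n → Set

  zeroV : ∀ {n} → V n
  zeroV = replicate _ 0#

  _⊕_ : ∀ {n} → V n → V n → V n
  _⊕_ = zipWith _+ᶠ_

  _·_ : ∀ {n} → Carrier → V n → V n
  c · v = map (c *ᶠ_) v

  vsum : ∀ {n} d → (Fin d → V n) → V n
  vsum zero    w = zeroV
  vsum (suc d) w = w zero ⊕ vsum d (λ i → w (suc i))

  lincomb : ∀ {n} d → (Fin d → Carrier) → (Fin d → V n) → V n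
  lincomb d c b = vsum d (λ i → c i · b i)

  InSpan : ∀ {n d} → (Fin d → V n) → V n → Set
  InSpan {n} {d} b v = ∃[ c ] (v ≡ lincomb d c b)

  LinIndep : ∀ {n d} → (Fin d → V n) → Set
  LinIndep {n} {d} b = ∀ c → lincomb d c b ≡ zeroV → ∀ i → c i ≡ 0#

  _≐_ : ∀ {n} → Pred n → Pred n → Set
  P ≐ Q = ∀ v → (P v → Q v) × (Q v → P v)

  IsSubspaceOfDim : ∀ {n} → ℕ → Pred n → Set
  IsSubspaceOfDim {n} d P =
    ∃[ b ] (LinIndep {n} {d} b × P ≐ InSpan b)

  _∩_ : ∀ {n} → Pred n → Pred n → Pred n
  (P ∩ Q) v = P v × Q v

  SumOf : ∀ {n} s → (Fin s → Pred n) → Pred n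
  SumOf {n} s S v = ∃[ w ] ((∀ i → S i (w i)) × v ≡ vsum s w)

  -- A family of m k-spaces of V(n,q), listed without repetition
  -- (a set, not a multiset).
  IsFamilyOfKSpaces : ∀ {n m} → ℕ → (Fin m → Pred n) → Set
  IsFamilyOfKSpaces {n} {m} k 𝓕 =
    (∀ i → IsSubspaceOfDim k (𝓕 i)) ×
    (∀ i j → i ≢ j → ¬ (𝓕 i ≐ 𝓕 j))

  IsSunflower : ∀ {n} s k → (Fin s → Pred n) → Set₁
  IsSunflower {n} s k S =
    (∀ i → IsSubspaceOfDim k (S i)) ×
    (∀ i j → i ≢ j → ¬ (S i ≐ S j)) ×
    ∃[ d ] ∃[ K ] ( IsSubspaceOfDim d K
                  × (∀ i j → i ≢ j → K ≐ (S i ∩ S j))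
                  × IsSubspaceOfDim (d + s * (k ∸ d)) (SumOf s S))

  SunflowerFree : ∀ {n m} → ℕ → ℕ → (Fin m → Pred n) → Set₁
  SunflowerFree {n} {m} s k 𝓕 =
    ∀ (ι : Fin s → Fin m) → (∀ i j → ι i ≡ ι j → i ≡ j) →
    ¬ IsSunflower s k (λ i → 𝓕 (ι i))

-- Gaussian integers [m]_q = (q^m - 1)/(q - 1) = 1 + q + ... + q^(m-1)

[_]_ : ℕ → ℕ → ℕ
[ zero  ] q = 0
[ suc m ] q = q ^ m + [ m ] q

prodBound : ℕ → ℕ → ℕ → ℕ
prodBound q s zero    = 1
prodBound q s (suc i) = prodBound q s i * [ suc i * (s ∸ 1) ] q

{-# OPTIONS --safe #-}

-- Upper bound. Fix a d-space K and consider the members of the family that contain K. Choose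
-- greedily as many of them as possible in general position modulo K: at most s − 1, as s of them
-- form a sunflower. Every member then meets their sum outside K, hence contains one of the at
-- most [(k − d)(s − 1)]_q points of a complement of K in that sum. Add this point to K and
-- induct on k − d.
--
-- Lower bounds. Put t = s − 1 and take the graphs U_M = { (a , aM) : a ∈ F^k } of symmetric k × k
-- matrices M with entries in F^t. If U_M contains (u , y), then it lies in the kernel of the t
-- functionals (a , m) ↦ Σ_j u_j m_j − Σ_j a_j y_j. So the sum of a sunflower with a kernel of
-- dimension d has codimension at least d t in F^k ⊕ (F^t)^k, which leaves just enough room, as
-- d + s (k − d) = k s − d t. One more functional rules the sunflower out. Inject the indices j < k
-- into r × t as (ρ j , σ j), where k ≤ r t, and require Σ_{ρ j = R} (M_ij)_{σ j} = 0 for all i and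
-- all R < r. For every j₀ this makes (a , m) ↦ Σ_{ρ j = ρ j₀} (m_j)_{σ j} vanish on all U_M, and
-- if the unit vector e_{j₀} is outside the projection of the kernel to F^k, then this functional
-- is independent of the others. The k r linear conditions leave at least
-- q^(t C(k+1,2) − k r) matrices. For s ≥ k + 1 take r = 1; for s ≤ k some r with
-- 2 r + gcd(k , s − 1) ≤ k + 4 suffices.

module Submission where

open import Defs
open import Algebra.Bundles using (CommutativeRing)
open import Data.Empty using (⊥-elim)
open import Data.Fin as Fin using (Fin; zero; suc; _↑ˡ_; _↑ʳ_; combine; remQuot)
import Data.Fin.Properties as Finₚ
open import Data.List as List using (List; []; _∷_; length; filter; allFin)
open import Data.List.Membership.Propositional using (_∈_; lose; find)
import Data.List.Membership.Propositional.Properties as ∈ₚ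
import Data.List.Properties as Listₚ
open import Data.List.Relation.Unary.All as All using (All; []; _∷_)
import Data.List.Relation.Unary.All.Properties as Allₚ
open import Data.List.Relation.Unary.AllPairs using ([]; _∷_)
open import Data.List.Relation.Unary.Any as Any using (Any; here; there)
import Data.List.Relation.Unary.Any.Properties as Anyₚ
open import Data.List.Relation.Unary.Unique.Propositional using (Unique)
import Data.List.Relation.Unary.Unique.Propositional.Properties as Uniqueₚ
open import Data.Nat as ℕ using (ℕ; zero; suc; _≤_; _<_; z≤n; s≤s)
open import Data.Nat.DivMod using (m*n/n≡m; /-monoˡ-≤; +-distrib-/-∣ˡ)
open import Data.Nat.Divisibility using (_∣_; divides; ∣⇒≤)
open import Data.Nat.GCD using (gcd; gcd[m,n]∣m; gcd[m,n]∣n)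
import Data.Nat.Properties as ℕₚ
open import Data.Nat.Tactic.RingSolver using (solve-∀)
open import Data.Product as Product using (Σ; ∃; ∃-syntax; _×_; _,_; proj₁; proj₂; uncurry)
open import Data.Sum as Sum using (_⊎_; inj₁; inj₂)
open import Data.Unit using (⊤; tt)
open import Data.Vec as Vec using ([]; _∷_; lookup; tabulate)
open import Data.Vec.Functional as VF using (Vector)
import Data.Vec.Functional.Properties as VFₚ
import Data.Vec.Properties as Vecₚ
open import Function using (_∘_; id; Injective; Inverse)
open import Relation.Binary.PropositionalEquality hiding ([_])
open import Relation.Nullary using (¬_; Dec; yes; no; ¬?)
import Relation.Nullary.Decidable as Dec

-- Arithmetic of the bounds

module Arithmetic where
  open import Data.Nat
  open import Data.Nat.Combinatorics using (_C_; nC1≡n; nCk+nC[k+1]≡[n+1]C[k+1])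
  open import Data.Nat.Properties

  -- C(k + 1, 2) in the recursive form that fits symmetric matrices: order k + 1 means a first row
  -- of k + 1 entries and then a symmetric matrix of order k.
  tri : ℕ → ℕ
  tri zero    = 0
  tri (suc k) = suc k + tri k

  tri≡C : ∀ k → tri k ≡ suc k C 2
  tri≡C zero    = refl
  tri≡C (suc k) = begin
    suc k + tri k            ≡⟨ cong₂ _+_ (sym (nC1≡n (suc k))) (tri≡C k) ⟩
    suc k C 1 + suc k C 2    ≡⟨ nCk+nC[k+1]≡[n+1]C[k+1] (suc k) 1 ⟩
    suc (suc k) C 2          ∎
    where open ≡-Reasoning

  2*tri : ∀ k → 2 * tri k ≡ k * suc k
  2*tri zero    = refl
  2*tri (suc k) = begin
    2 * (suc k + tri k)          ≡⟨ *-distribˡ-+ 2 (suc k) (tri k) ⟩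
    2 * suc k + 2 * tri k        ≡⟨ cong (2 * suc k +_) (2*tri k) ⟩
    2 * suc k + k * suc k        ≡⟨ *-distribʳ-+ (suc k) 2 k ⟨
    suc (suc k) * suc k          ≡⟨ *-comm (suc (suc k)) (suc k) ⟩
    suc k * suc (suc k)          ∎
    where open ≡-Reasoning

  k≤tri : ∀ k → k ≤ tri k
  k≤tri zero    = z≤n
  k≤tri (suc k) = m≤m+n (suc k) (tri k)

  1+[m]*[q-1]≡q^m : ∀ p m → suc ([ m ] suc p * p) ≡ suc p ^ m
  1+[m]*[q-1]≡q^m p zero    = refl
  1+[m]*[q-1]≡q^m p (suc m) = begin
    suc ((suc p ^ m + [ m ] suc p) * p)            ≡⟨ cong suc (*-distribʳ-+ p (suc p ^ m) ([ m ] suc p)) ⟩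
    suc (suc p ^ m * p + [ m ] suc p * p)          ≡⟨ +-suc _ _ ⟨
    suc p ^ m * p + suc ([ m ] suc p * p)          ≡⟨ cong₂ _+_ (*-comm (suc p ^ m) p) (1+[m]*[q-1]≡q^m p m) ⟩
    p * suc p ^ m + suc p ^ m                      ≡⟨ +-comm (p * suc p ^ m) _ ⟩
    suc p ^ suc m                                  ∎
    where open ≡-Reasoning

  -- Each factor satisfies [m]_q (q - 1) < q^m, and the exponents i t for i ≤ k add up to t C(k + 1,
  -- 2). With q written as `suc p`, the number q - 1 is simply `p`.
  prodBound-≤ : ∀ p t k → prodBound (suc p) (suc t) k * p ^ k ≤ suc p ^ (t * tri k)
  prodBound-≤ p t zero    = ≤-reflexive (cong (suc p ^_) (sym (*-zeroʳ t)))
  prodBound-≤ p t (suc k) = begin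
    P * [ suc k * t ] suc p * (p * p ^ k)        ≡⟨ rearrange P ([ suc k * t ] suc p) p (p ^ k) ⟩
    [ suc k * t ] suc p * p * (P * p ^ k)        ≤⟨ *-mono-≤ (≤-trans (n≤1+n _) (≤-reflexive (1+[m]*[q-1]≡q^m p (suc k * t)))) (prodBound-≤ p t k) ⟩
    suc p ^ (suc k * t) * suc p ^ (t * tri k)    ≡⟨ ^-distribˡ-+-* (suc p) (suc k * t) (t * tri k) ⟨
    suc p ^ (suc k * t + t * tri k)              ≡⟨ cong (suc p ^_) (trans (cong (_+ t * tri k) (*-comm (suc k) t)) (sym (*-distribˡ-+ t (suc k) (tri k)))) ⟩
    suc p ^ (t * tri (suc k))                    ∎
    where
    open ≤-Reasoning
    P : ℕ
    P = prodBound (suc p) (suc t) k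
    rearrange : ∀ a b c d → a * b * (c * d) ≡ b * c * (a * d)
    rearrange = solve-∀

  prodBound-upper : ∀ q t k → 1 ≤ q → 1 ≤ t → prodBound q (suc t) k * (q ∸ 1) ^ k ≤ q ^ k * q ^ (t * (suc k C 2) ∸ k)
  prodBound-upper (suc p) t k _ 1≤t = begin
    prodBound (suc p) (suc t) k * p ^ k              ≤⟨ prodBound-≤ p t k ⟩
    -- As t ≥ 1, the subtraction of k does not truncate.
    suc p ^ (t * tri k)                              ≡⟨ cong (suc p ^_) (m+[n∸m]≡n (≤-trans (k≤tri k) (m≤n*m (tri k) t {{>-nonZero 1≤t}}))) ⟨
    suc p ^ (k + (t * tri k ∸ k))                    ≡⟨ ^-distribˡ-+-* (suc p) k _ ⟩
    suc p ^ k * suc p ^ (t * tri k ∸ k)              ≡⟨ cong (λ x → suc p ^ k * suc p ^ (t * x ∸ k)) (tri≡C k) ⟩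
    suc p ^ k * suc p ^ (t * (suc k C 2) ∸ k)        ∎
    where open ≤-Reasoning

  -- The witness k/g (⌈k/2⌉ if g = 1) need not be the least r with k ≤ r t, but is easy to estimate.
  rows : ∀ t k g → 2 ≤ t → t < k → g ∣ t → g ∣ k → ∃[ r ] k ≤ r * t × 2 * r + g ≤ k + 4 × 1 ≤ g
  rows t k zero          2≤t t<k (divides c t≡0) _ = ⊥-elim (<⇒≱ (≤-trans (s≤s z≤n) 2≤t) (≤-reflexive (trans t≡0 (*-zeroʳ c))))
  rows t k (suc zero)    2≤t t<k g∣t g∣k = ⌈ k /2⌉ , k≤ , bound , s≤s z≤n
    where
    2⌈k/2⌉ : ∀ k → k ≤ ⌈ k /2⌉ * 2 × ⌈ k /2⌉ * 2 ≤ suc k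
    2⌈k/2⌉ zero          = z≤n , z≤n
    2⌈k/2⌉ (suc zero)    = s≤s z≤n , ≤-refl
    2⌈k/2⌉ (suc (suc k)) = Product.map (s≤s ∘ s≤s) (s≤s ∘ s≤s) (2⌈k/2⌉ k)
    k≤ : k ≤ ⌈ k /2⌉ * t
    k≤ = ≤-trans (proj₁ (2⌈k/2⌉ k)) (*-monoʳ-≤ ⌈ k /2⌉ 2≤t)
    bound : 2 * ⌈ k /2⌉ + 1 ≤ k + 4
    bound = begin
      2 * ⌈ k /2⌉ + 1   ≡⟨ cong (_+ 1) (*-comm 2 ⌈ k /2⌉) ⟩
      ⌈ k /2⌉ * 2 + 1   ≤⟨ +-monoˡ-≤ 1 (proj₂ (2⌈k/2⌉ k)) ⟩
      suc k + 1         ≡⟨ +-suc k 1 ⟨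
      k + 2             ≤⟨ +-monoʳ-≤ k (s≤s (s≤s z≤n)) ⟩
      k + 4             ∎
      where open ≤-Reasoning
  rows t k g@(suc (suc h)) 2≤t t<k g∣t (divides c k≡cg) = c , k≤ , bound , s≤s z≤n
    where
    instance
      t≢0 : NonZero t
      t≢0 = >-nonZero (≤-trans (s≤s z≤n) 2≤t)
    g≤t : g ≤ t
    g≤t = ∣⇒≤ g∣t
    k≤ : k ≤ c * t
    k≤ = ≤-trans (≤-reflexive k≡cg) (*-monoʳ-≤ c g≤t)
    1≤c : 1 ≤ c
    1≤c = n≢0⇒n>0 λ { refl → <⇒≱ (≤-trans (s≤s z≤n) t<k) (≤-reflexive k≡cg) }
    bound : 2 * c + g ≤ k + 4
    bound = begin
      2 * c + g                       ≡⟨ cong (λ x → 2 * x + g) (m+[n∸m]≡n 1≤c) ⟨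
      -- For g = 2 + h and k = c g the gap between the two sides is exactly (c - 1) h + 2.
      2 * (1 + (c ∸ 1)) + g           ≤⟨ m≤m+n _ ((c ∸ 1) * h + 2) ⟩
      2 * (1 + (c ∸ 1)) + g + ((c ∸ 1) * h + 2) ≡⟨ identity (c ∸ 1) h ⟩
      (1 + (c ∸ 1)) * g + 4           ≡⟨ cong (λ x → x * g + 4) (m+[n∸m]≡n 1≤c) ⟩
      c * g + 4                       ≡⟨ cong (_+ 4) k≡cg ⟨
      k + 4                           ∎
      where
      open ≤-Reasoning
      identity : ∀ c h → 2 * (1 + c) + (2 + h) + (c * h + 2) ≡ (1 + c) * (2 + h) + 4
      identity = solve-∀

  -- Here `t` stands for s - 2. Cleared of the halving and the subtraction, the claim is k (2r + g)
  -- ≤ k (k + 4), because 2 C(k + 1, 2) + 3k = k (k + 4).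
  exponent-≤ : ∀ t k r g → 1 ≤ k → 2 ≤ suc t → 1 ≤ g → 2 * r + g ≤ k + 4 →
               k * r + (2 * (t * (suc k C 2)) + k * g ∸ 3 * k) / 2 ≤ suc t * tri k
  exponent-≤ t k r g 1≤k 2≤1+t 1≤g bound = begin
    k * r + X / 2                          ≡⟨ cong (_+ X / 2) (m*n/n≡m (k * r) 2) ⟨
    k * r * 2 / 2 + X / 2                  ≡⟨ +-distrib-/-∣ˡ X (divides (k * r) refl) ⟨
    (k * r * 2 + X) / 2                    ≤⟨ /-monoˡ-≤ 2 total ⟩
    suc t * tri k * 2 / 2                  ≡⟨ m*n/n≡m (suc t * tri k) 2 ⟩
    suc t * tri k                          ∎
    where
    open ≤-Reasoning
    X : ℕ
    X = 2 * (t * (suc k C 2)) + k * g ∸ 3 * k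
    A : ℕ
    A = 2 * (t * (suc k C 2)) + k * g
    A≡ : A ≡ 2 * (t * tri k) + k * g
    A≡ = cong (λ x → 2 * (t * x) + k * g) (sym (tri≡C k))
    large : k * r * 2 + A ≤ suc t * tri k * 2 + 3 * k
    large = begin
      k * r * 2 + A                                    ≡⟨ cong (k * r * 2 +_) A≡ ⟩
      k * r * 2 + (2 * (t * tri k) + k * g)            ≡⟨ identity₁ k r g (t * tri k) ⟩
      k * (2 * r + g) + 2 * (t * tri k)                ≤⟨ +-monoˡ-≤ _ (*-monoʳ-≤ k bound) ⟩
      k * (k + 4) + 2 * (t * tri k)                    ≡⟨ identity₂ k (t * tri k) ⟩
      k * suc k + 2 * (t * tri k) + 3 * k              ≡⟨ cong (λ x → x + 2 * (t * tri k) + 3 * k) (2*tri k) ⟨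
      2 * tri k + 2 * (t * tri k) + 3 * k              ≡⟨ identity₃ k t (tri k) ⟩
      suc t * tri k * 2 + 3 * k                        ∎
      where
      identity₁ : ∀ k r g x → k * r * 2 + (2 * x + k * g) ≡ k * (2 * r + g) + 2 * x
      identity₁ = solve-∀
      identity₂ : ∀ k x → k * (k + 4) + 2 * x ≡ k * suc k + 2 * x + 3 * k
      identity₂ = solve-∀
      identity₃ : ∀ k t x → 2 * x + 2 * (t * x) + 3 * k ≡ suc t * x * 2 + 3 * k
      identity₃ = solve-∀
    -- For the case where `X` truncates to 0, when `large` says too little. Then r ≤ k + 1 and t + 1
    -- ≥ 2 suffice.
    small : k * r * 2 ≤ suc t * tri k * 2
    small = begin
      k * r * 2                  ≡⟨ trans (*-assoc k r 2) (cong (k *_) (*-comm r 2)) ⟩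
      k * (2 * r)                ≤⟨ *-monoʳ-≤ k 2r≤ ⟩
      k * (suc k * 2)            ≡⟨ *-assoc k (suc k) 2 ⟨
      k * suc k * 2              ≤⟨ *-monoʳ-≤ (k * suc k) 2≤1+t ⟩
      k * suc k * suc t          ≡⟨ cong (_* suc t) (2*tri k) ⟨
      2 * tri k * suc t          ≡⟨ trans (*-comm (2 * tri k) (suc t)) (trans (cong (suc t *_) (*-comm 2 (tri k))) (sym (*-assoc (suc t) (tri k) 2))) ⟩
      suc t * tri k * 2          ∎
      where
      2r≤ : 2 * r ≤ suc k * 2
      2r≤ = +-cancelʳ-≤ 1 (2 * r) (suc k * 2) (begin
        2 * r + 1         ≤⟨ +-monoʳ-≤ (2 * r) 1≤g ⟩
        2 * r + g         ≤⟨ bound ⟩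
        k + 4             ≡⟨ +-suc k 3 ⟩
        1 + k + 3         ≤⟨ +-monoˡ-≤ 3 (+-monoˡ-≤ k 1≤k) ⟩
        k + k + 3         ≡⟨ identity k ⟩
        suc k * 2 + 1     ∎)
        where
        identity : ∀ k → k + k + 3 ≡ suc k * 2 + 1
        identity = solve-∀
    total : k * r * 2 + X ≤ suc t * tri k * 2
    total with ≤-total (3 * k) A
    ... | inj₂ A≤3k = ≤-trans (≤-reflexive (trans (cong (k * r * 2 +_) (m≤n⇒m∸n≡0 A≤3k)) (+-identityʳ _))) small
    ... | inj₁ 3k≤A = +-cancelʳ-≤ (3 * k) _ _ (≤-trans (≤-reflexive (trans (+-assoc (k * r * 2) X (3 * k)) (cong (k * r * 2 +_) (m∸n+n≡m 3k≤A)))) large)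

  -- From k g ≥ k follows 2x + k g - 3k ≥ 2 (x - k), also with truncated subtraction.
  exponent-≥ : ∀ x k g → 1 ≤ g → x ∸ k ≤ (2 * x + k * g ∸ 3 * k) / 2
  exponent-≥ x k g 1≤g = begin
    x ∸ k                              ≡⟨ m*n/n≡m (x ∸ k) 2 ⟨
    (x ∸ k) * 2 / 2                    ≤⟨ /-monoˡ-≤ 2 (begin
      (x ∸ k) * 2                        ≡⟨ trans (*-distribʳ-∸ 2 x k) (cong₂ _∸_ (*-comm x 2) (*-comm k 2)) ⟩
      2 * x ∸ 2 * k                      ≡⟨ [m+n]∸[m+o]≡n∸o k (2 * x) (2 * k) ⟨
      k + 2 * x ∸ 3 * k                  ≤⟨ ∸-monoˡ-≤ (3 * k) (≤-trans (≤-reflexive (+-comm k (2 * x))) (+-monoʳ-≤ (2 * x) (m≤m*n k g {{>-nonZero 1≤g}}))) ⟩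
      2 * x + k * g ∸ 3 * k              ∎) ⟩
    (2 * x + k * g ∸ 3 * k) / 2        ∎
    where open ≤-Reasoning

open Arithmetic

[]-mono : ∀ q {m n} → m ≤ n → [ m ] q ≤ [ n ] q
[]-mono q m≤n = go (ℕₚ.≤⇒≤′ m≤n)
  where
  go : ∀ {m n} → m ℕ.≤′ n → [ m ] q ≤ [ n ] q
  go ℕ.≤′-refl       = ℕₚ.≤-refl
  go (ℕ.≤′-step m≤n) = ℕₚ.≤-trans (go m≤n) (ℕₚ.m≤n+m _ _)

-- With s = t + 1: the dimension of the sum of a sunflower and the number 1 + d t of functionals
-- vanishing on it together exceed the ambient dimension k s by exactly one.
sunflower-dim : ∀ t {d k} → d ≤ k → suc (k ℕ.* suc t) ≡ d ℕ.+ suc t ℕ.* (k ℕ.∸ d) ℕ.+ suc (d ℕ.* t)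
sunflower-dim t {d} {k} d≤k = trans (cong (λ x → suc (x ℕ.* suc t)) (sym (ℕₚ.m+[n∸m]≡n d≤k))) (identity d (k ℕ.∸ d) t)
  where
  identity : ∀ d e t → suc ((d ℕ.+ e) ℕ.* suc t) ≡ d ℕ.+ suc t ℕ.* e ℕ.+ suc (d ℕ.* t)
  identity = solve-∀

-- Counting with lists

length-filter-split : ∀ {A : Set} {P : A → Set} (P? : ∀ x → Dec (P x)) xs →
                      length xs ≡ length (filter P? xs) ℕ.+ length (filter (¬? ∘ P?) xs)
length-filter-split P? []       = refl
length-filter-split P? (x ∷ xs) with P? x
... | yes _ = cong suc (length-filter-split P? xs)
... | no  _ = trans (cong suc (length-filter-split P? xs)) (sym (ℕₚ.+-suc _ _))

-- A union bound: each `x` is charged to the first `y` of the list related to it, and the list is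
-- filtered accordingly. `P` is a side condition handed on to every fibre.
count-by : ∀ {A B : Set} {P : A → Set} {R : A → B → Set} (R? : ∀ x y → Dec (R x y)) {N} (ys : List B) →
           (∀ {y} → y ∈ ys → ∀ {xs} → Unique xs → All P xs → All (λ x → R x y) xs → length xs ≤ N) →
           ∀ {xs} → Unique xs → All P xs → All (λ x → Any (R x) ys) xs → length xs ≤ length ys ℕ.* N
count-by R? []       fibre {[]}    _   _   _        = z≤n
count-by R? []       fibre {_ ∷ _} _   _   (() ∷ _)
count-by {R = R} R? {N} (y ∷ ys) fibre {xs} xs! Pxs meet = begin
  length xs                                                                      ≡⟨ length-filter-split (λ x → R? x y) xs ⟩
  length (filter (λ x → R? x y) xs) ℕ.+ length (filter (λ x → ¬? (R? x y)) xs)   ≤⟨ ℕₚ.+-mono-≤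
    (fibre (here refl) (Uniqueₚ.filter⁺ _ xs!) (Allₚ.filter⁺ _ Pxs) (Allₚ.all-filter _ xs))
    (count-by R? ys (fibre ∘ there) (Uniqueₚ.filter⁺ _ xs!) (Allₚ.filter⁺ _ Pxs)
      (All.zipWith (λ { (¬Rxy , here Rxy) → ⊥-elim (¬Rxy Rxy) ; (_ , there Rx) → Rx })
        (Allₚ.all-filter (λ x → ¬? (R? x y)) xs , Allₚ.filter⁺ _ meet))) ⟩
  N ℕ.+ length ys ℕ.* N                                                          ∎
  where open ℕₚ.≤-Reasoning

∈-remove : ∀ {A : Set} {x z : A} {ys} (x∈ : x ∈ ys) → z ∈ ys → z ≢ x → z ∈ (ys Any.─ x∈)
∈-remove (here refl) (here refl) z≢x = ⊥-elim (z≢x refl)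
∈-remove (here refl) (there z∈)  z≢x = z∈
∈-remove (there x∈)  (here refl) z≢x = here refl
∈-remove (there x∈)  (there z∈)  z≢x = there (∈-remove x∈ z∈ z≢x)

-- Strike the head of `xs` out of `ys`; the tail, free of repetitions of the head, still fits into
-- the rest.
unique-⊆⇒≤ : ∀ {A : Set} {xs ys : List A} → Unique xs → (∀ {x} → x ∈ xs → x ∈ ys) → length xs ≤ length ys
unique-⊆⇒≤ []               xs⊆ys = z≤n
unique-⊆⇒≤ {ys = ys} (x∉xs ∷ xs!) xs⊆ys = ℕₚ.≤-trans
  (s≤s (unique-⊆⇒≤ xs! (λ z∈ → ∈-remove x∈ys (xs⊆ys (there z∈)) (λ { refl → All.lookup x∉xs z∈ refl }))))
  (ℕₚ.≤-reflexive (sym (Listₚ.length-removeAt′ ys (Any.index x∈ys))))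
  where x∈ys = xs⊆ys (here refl)

unique⇒lookup-injective : ∀ {A : Set} {xs : List A} → Unique xs → ∀ i j → List.lookup xs i ≡ List.lookup xs j → i ≡ j
unique⇒lookup-injective (_    ∷ _)   zero    zero    _  = refl
unique⇒lookup-injective (x∉xs ∷ _)   zero    (suc j) eq = ⊥-elim (All.lookup x∉xs (∈ₚ.∈-lookup j) eq)
unique⇒lookup-injective (x∉xs ∷ _)   (suc i) zero    eq = ⊥-elim (All.lookup x∉xs (∈ₚ.∈-lookup i) (sym eq))
unique⇒lookup-injective (_    ∷ xs!) (suc i) (suc j) eq = cong suc (unique⇒lookup-injective xs! i j eq)

-- Indices of the entries of a symmetric matrix

-- Both positions (i , j) and (j , i) share one index, so symmetry is built into the coordinates and
-- the symmetric matrices form a full coordinate space.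
triIndex : ∀ {k} → Fin k → Fin k → Fin (tri k)
triIndex {suc k} zero    j       = j ↑ˡ tri k
triIndex {suc k} (suc i) zero    = suc i ↑ˡ tri k
triIndex {suc k} (suc i) (suc j) = suc k ↑ʳ triIndex i j

triIndex-sym : ∀ {k} (i j : Fin k) → triIndex i j ≡ triIndex j i
triIndex-sym         zero    zero    = refl
triIndex-sym         zero    (suc j) = refl
triIndex-sym         (suc i) zero    = refl
triIndex-sym {suc k} (suc i) (suc j) = cong (suc k ↑ʳ_) (triIndex-sym i j)

triIndex-surjective : ∀ {k} (x : Fin (tri k)) → ∃[ i ] ∃[ j ] triIndex {k} i j ≡ x
triIndex-surjective {suc k} x with Fin.splitAt (suc k) x in eq
... | inj₁ j = zero , j , Finₚ.splitAt⁻¹-↑ˡ eq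
... | inj₂ y with i , j , refl ← triIndex-surjective {k} y = suc i , suc j , Finₚ.splitAt⁻¹-↑ʳ eq

-- Linear algebra over a finite field

module LinearAlgebra {q} (𝔽 : FiniteField q) where

  open FiniteField 𝔽 public renaming (Carrier to F)

  commutativeRing : CommutativeRing _ _
  commutativeRing = record { isCommutativeRing = isCommutativeRing }

  open CommutativeRing commutativeRing public
    using (_+_; _*_; -_; semiring; ring; distribˡ; distribʳ; zeroˡ; zeroʳ; -‿inverseˡ; -‿inverseʳ;
           +-identityˡ; +-identityʳ; +-assoc; +-comm; *-identityˡ; *-identityʳ; *-assoc; *-comm)
  import Algebra.Properties.Semiring.Sum semiring as Sums
  open import Algebra.Properties.Ring ring public
    using (-‿distribˡ-*; -1*x≈-x)
  open import Algebra.Properties.CommutativeSemigroup (CommutativeRing.*-commutativeSemigroup commutativeRing) public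
    using () renaming (x∙yz≈y∙xz to x*yz≡y*xz)

  open ≡-Reasoning

  𝕍 : ℕ → Set
  𝕍 = V 𝔽

  infixl 6 _+ᵛ_
  infixr 7 _*ᵛ_

  _+ᵛ_ : ∀ {n} → 𝕍 n → 𝕍 n → 𝕍 n
  _+ᵛ_ = _⊕_ 𝔽

  _*ᵛ_ : ∀ {n} → F → 𝕍 n → 𝕍 n
  _*ᵛ_ = _·_ 𝔽

  0ᵛ : ∀ {n} → 𝕍 n
  0ᵛ = zeroV 𝔽

  span : ∀ {n d} → Vector (𝕍 n) d → 𝕍 n → Set
  span = InSpan 𝔽

  Indep : ∀ {n d} → Vector (𝕍 n) d → Set
  Indep = LinIndep 𝔽

  lin : ∀ {n d} → Vector F d → Vector (𝕍 n) d → 𝕍 n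
  lin = lincomb 𝔽 _

  index : F → Fin q
  index = Inverse.to cardinality

  element : Fin q → F
  element = Inverse.from cardinality

  element-index : ∀ x → element (index x) ≡ x
  element-index = Inverse.strictlyInverseʳ cardinality

  index-element : ∀ i → index (element i) ≡ i
  index-element = Inverse.strictlyInverseˡ cardinality

  index-injective : ∀ {x y} → index x ≡ index y → x ≡ y
  index-injective {x} {y} eq = trans (sym (element-index x)) (trans (cong element eq) (element-index y))

  element-injective : ∀ {i j} → element i ≡ element j → i ≡ j
  element-injective {i} {j} eq = trans (sym (index-element i)) (trans (cong index eq) (index-element j))

  _≟F_ : (x y : F) → Dec (x ≡ y)
  x ≟F y = Dec.map′ index-injective (cong index) (index x Fin.≟ index y)

  _≟ᵛ_ : ∀ {n} (u v : 𝕍 n) → Dec (u ≡ v)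
  _≟ᵛ_ = Vecₚ.≡-dec _≟F_

  ∃F? : ∀ {p} {P : F → Set p} → (∀ x → Dec (P x)) → Dec (∃ P)
  ∃F? {P = P} P? = Dec.map′
    (λ (i , p) → element i , p)
    (λ (x , p) → index x , subst P (sym (element-index x)) p)
    (Finₚ.any? (λ i → P? (element i)))

  1<q : 1 < q
  1<q = Finₚ.injective⇒≤ {f = g} g-injective
    where
    g : Fin 2 → Fin q
    g zero       = index 0#
    g (suc zero) = index 1#
    g-injective : Injective _≡_ _≡_ g
    g-injective {zero}     {zero}     _  = refl
    g-injective {zero}     {suc zero} eq = ⊥-elim (0≢1 (index-injective eq))
    g-injective {suc zero} {zero}     eq = ⊥-elim (0≢1 (sym (index-injective eq)))
    g-injective {suc zero} {suc zero} _  = refl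

  inv : ∀ x → x ≢ 0# → ∃[ y ] y * x ≡ 1#
  inv x x≢0 with y , xy≡1 ← inverse x x≢0 = y , trans (*-comm y x) xy≡1

  -- Finite sums

  -- Opaque, since unfolding to foldr would defeat unification.
  opaque
    sum : ∀ {d} → Vector F d → F
    sum = Sums.sum

    sum-[] : (f : Vector F 0) → sum f ≡ 0#
    sum-[] f = refl

    sum-∷ : ∀ {d} (f : Vector F (suc d)) → sum f ≡ f zero + sum (f ∘ suc)
    sum-∷ f = refl

    sum-cong : ∀ {d} {f g : Vector F d} → (∀ i → f i ≡ g i) → sum f ≡ sum g
    sum-cong = Sums.sum-cong-≗

    sum-+ : ∀ {d} (f g : Vector F d) → sum (λ i → f i + g i) ≡ sum f + sum g
    sum-+ = Sums.∑-distrib-+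

    sum-comm : ∀ {d e} (f : Fin d → Fin e → F) → sum (λ i → sum (f i)) ≡ sum (λ j → sum (λ i → f i j))
    sum-comm = Sums.∑-comm

    *-distribˡ-sum : ∀ {d} x (f : Vector F d) → x * sum f ≡ sum (λ i → x * f i)
    *-distribˡ-sum = Sums.*-distribˡ-sum

    *-distribʳ-sum : ∀ {d} x (f : Vector F d) → sum f * x ≡ sum (λ i → f i * x)
    *-distribʳ-sum = Sums.*-distribʳ-sum

    sum-zero : ∀ {d} {f : Vector F d} → (∀ i → f i ≡ 0#) → sum f ≡ 0#
    sum-zero {d} f≡0 = trans (sum-cong f≡0) (Sums.sum-replicate-zero d)

  δ : ∀ {d} → Fin d → Fin d → F
  δ zero    zero    = 1#
  δ zero    (suc j) = 0#
  δ (suc i) zero    = 0#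
  δ (suc i) (suc j) = δ i j

  δ-refl : ∀ {d} (i : Fin d) → δ i i ≡ 1#
  δ-refl zero    = refl
  δ-refl (suc i) = δ-refl i

  δ-≢ : ∀ {d} {i j : Fin d} → i ≢ j → δ i j ≡ 0#
  δ-≢ {i = zero}  {zero}  i≢j = ⊥-elim (i≢j refl)
  δ-≢ {i = zero}  {suc j} i≢j = refl
  δ-≢ {i = suc i} {zero}  i≢j = refl
  δ-≢ {i = suc i} {suc j} i≢j = δ-≢ (i≢j ∘ cong suc)

  δ-sym : ∀ {d} (i j : Fin d) → δ i j ≡ δ j i
  δ-sym zero    zero    = refl
  δ-sym zero    (suc j) = refl
  δ-sym (suc i) zero    = refl
  δ-sym (suc i) (suc j) = δ-sym i j

  sum-δ : ∀ {d} (i : Fin d) (f : Vector F d) → sum (λ j → δ i j * f j) ≡ f i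
  sum-δ zero    f = begin
    sum (λ j → δ zero j * f j)                ≡⟨ sum-∷ _ ⟩
    1# * f zero + sum (λ j → 0# * f (suc j))  ≡⟨ cong₂ _+_ (*-identityˡ _) (sum-zero (λ j → zeroˡ _)) ⟩
    f zero + 0#                               ≡⟨ +-identityʳ _ ⟩
    f zero                                    ∎
  sum-δ (suc i) f = begin
    sum (λ j → δ (suc i) j * f j)                ≡⟨ sum-∷ _ ⟩
    0# * f zero + sum (λ j → δ i j * f (suc j))  ≡⟨ cong₂ _+_ (zeroˡ _) (sum-δ i (f ∘ suc)) ⟩
    0# + f (suc i)                               ≡⟨ +-identityˡ _ ⟩
    f (suc i)                                    ∎

  sum-δʳ : ∀ {d} (i : Fin d) (f : Vector F d) → sum (λ j → f j * δ j i) ≡ f i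
  sum-δʳ i f = trans (sum-cong (λ j → trans (*-comm _ _) (cong (_* f j) (δ-sym j i)))) (sum-δ i f)

  sum-↑ : ∀ m {n} (f : Vector F (m ℕ.+ n)) → sum f ≡ sum (λ i → f (i ↑ˡ n)) + sum (λ j → f (m ↑ʳ j))
  sum-↑ zero        f = sym (trans (cong (_+ sum f) (sum-[] _)) (+-identityˡ _))
  sum-↑ (suc m) {n} f = begin
    sum f                                                                                     ≡⟨ sum-∷ f ⟩
    f zero + sum (f ∘ suc)                                                                    ≡⟨ cong (f zero +_) (sum-↑ m (f ∘ suc)) ⟩
    f zero + (sum (λ i → f (suc i ↑ˡ n)) + sum (λ j → f (suc m ↑ʳ j)))                        ≡⟨ +-assoc _ _ _ ⟨
    f zero + sum (λ i → f (suc i ↑ˡ n)) + sum (λ j → f (suc m ↑ʳ j))                          ≡⟨ cong (_+ sum (λ j → f (suc m ↑ʳ j))) (sum-∷ (λ i → f (i ↑ˡ n))) ⟨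
    sum (λ i → f (i ↑ˡ n)) + sum (λ j → f (suc m ↑ʳ j))                                       ∎

  sum-combine : ∀ m {n} (f : Vector F (m ℕ.* n)) → sum f ≡ sum (λ i → sum (λ j → f (combine {m} {n} i j)))
  sum-combine zero        f = trans (sum-[] f) (sym (sum-[] _))
  sum-combine (suc m) {n} f = begin
    sum f                                                                          ≡⟨ sum-↑ n f ⟩
    sum (λ i → f (i ↑ˡ (m ℕ.* n))) + sum (λ j → f (n ↑ʳ j))                        ≡⟨ cong (sum (λ i → f (i ↑ˡ (m ℕ.* n))) +_) (sum-combine m (λ j → f (n ↑ʳ j))) ⟩
    sum (λ i → f (i ↑ˡ (m ℕ.* n))) + sum (λ i → sum (λ j → f (n ↑ʳ combine i j)))  ≡⟨ sum-∷ (λ i → sum (λ j → f (combine {suc m} i j))) ⟨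
    sum (λ i → sum (λ j → f (combine {suc m} i j)))                                ∎

  -- Linear combinations

  vec-ext : ∀ {n} {u v : 𝕍 n} → (∀ x → lookup u x ≡ lookup v x) → u ≡ v
  vec-ext {u = u} {v} eq = begin
    u                    ≡⟨ Vecₚ.tabulate∘lookup u ⟨
    tabulate (lookup u)  ≡⟨ Vecₚ.tabulate-cong eq ⟩
    tabulate (lookup v)  ≡⟨ Vecₚ.tabulate∘lookup v ⟩
    v                    ∎

  lookup-+ᵛ : ∀ {n} (u v : 𝕍 n) x → lookup (u +ᵛ v) x ≡ lookup u x + lookup v x
  lookup-+ᵛ u v x = Vecₚ.lookup-zipWith _ x u v

  lookup-*ᵛ : ∀ {n} c (v : 𝕍 n) x → lookup (c *ᵛ v) x ≡ c * lookup v x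
  lookup-*ᵛ c v x = Vecₚ.lookup-map x _ v

  lookup-0ᵛ : ∀ {n} x → lookup (0ᵛ {n}) x ≡ 0#
  lookup-0ᵛ x = Vecₚ.lookup-replicate x 0#

  lookup-vsum : ∀ {n d} (w : Vector (𝕍 n) d) x → lookup (vsum 𝔽 d w) x ≡ sum (λ i → lookup (w i) x)
  lookup-vsum {d = zero}  w x = trans (lookup-0ᵛ x) (sym (sum-[] _))
  lookup-vsum {d = suc d} w x = trans (lookup-+ᵛ (w zero) _ x) (trans (cong (lookup (w zero) x +_) (lookup-vsum (w ∘ suc) x)) (sym (sum-∷ _)))

  lookup-lin : ∀ {n d} (c : Vector F d) (b : Vector (𝕍 n) d) x → lookup (lin c b) x ≡ sum (λ i → c i * lookup (b i) x)
  lookup-lin c b x = trans (lookup-vsum (λ i → c i *ᵛ b i) x) (sum-cong (λ i → lookup-*ᵛ (c i) (b i) x))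

  +ᵛ-identityˡ : ∀ {n} (v : 𝕍 n) → 0ᵛ +ᵛ v ≡ v
  +ᵛ-identityˡ v = Vecₚ.zipWith-identityˡ +-identityˡ v

  +ᵛ-identityʳ : ∀ {n} (v : 𝕍 n) → v +ᵛ 0ᵛ ≡ v
  +ᵛ-identityʳ v = Vecₚ.zipWith-identityʳ +-identityʳ v

  +ᵛ-comm : ∀ {n} (u v : 𝕍 n) → u +ᵛ v ≡ v +ᵛ u
  +ᵛ-comm = Vecₚ.zipWith-comm +-comm

  +ᵛ-assoc : ∀ {n} (u v w : 𝕍 n) → (u +ᵛ v) +ᵛ w ≡ u +ᵛ (v +ᵛ w)
  +ᵛ-assoc = Vecₚ.zipWith-assoc +-assoc

  +ᵛ-interchange : ∀ {n} (a b c d : 𝕍 n) → (a +ᵛ b) +ᵛ (c +ᵛ d) ≡ (a +ᵛ c) +ᵛ (b +ᵛ d)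
  +ᵛ-interchange a b c d = begin
    (a +ᵛ b) +ᵛ (c +ᵛ d)  ≡⟨ +ᵛ-assoc a b _ ⟩
    a +ᵛ (b +ᵛ (c +ᵛ d))  ≡⟨ cong (a +ᵛ_) (trans (sym (+ᵛ-assoc b c d)) (trans (cong (_+ᵛ d) (+ᵛ-comm b c)) (+ᵛ-assoc c b d))) ⟩
    a +ᵛ (c +ᵛ (b +ᵛ d))  ≡⟨ +ᵛ-assoc a c _ ⟨
    (a +ᵛ c) +ᵛ (b +ᵛ d)  ∎

  -ᵛ_ : ∀ {n} → 𝕍 n → 𝕍 n
  -ᵛ v = (- 1#) *ᵛ v

  *ᵛ-identityˡ : ∀ {n} (v : 𝕍 n) → 1# *ᵛ v ≡ v
  *ᵛ-identityˡ v = vec-ext λ x → trans (lookup-*ᵛ 1# v x) (*-identityˡ _)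

  *ᵛ-zeroˡ : ∀ {n} (v : 𝕍 n) → 0# *ᵛ v ≡ 0ᵛ
  *ᵛ-zeroˡ v = vec-ext λ x → trans (lookup-*ᵛ 0# v x) (trans (zeroˡ _) (sym (lookup-0ᵛ x)))

  *ᵛ-distribˡ : ∀ {n} c (u v : 𝕍 n) → c *ᵛ (u +ᵛ v) ≡ c *ᵛ u +ᵛ c *ᵛ v
  *ᵛ-distribˡ c u v = vec-ext λ x → begin
    lookup (c *ᵛ (u +ᵛ v)) x                     ≡⟨ lookup-*ᵛ c (u +ᵛ v) x ⟩
    c * lookup (u +ᵛ v) x                        ≡⟨ cong (c *_) (lookup-+ᵛ u v x) ⟩
    c * (lookup u x + lookup v x)                ≡⟨ distribˡ c _ _ ⟩
    c * lookup u x + c * lookup v x              ≡⟨ cong₂ _+_ (lookup-*ᵛ c u x) (lookup-*ᵛ c v x) ⟨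
    lookup (c *ᵛ u) x + lookup (c *ᵛ v) x        ≡⟨ lookup-+ᵛ (c *ᵛ u) (c *ᵛ v) x ⟨
    lookup (c *ᵛ u +ᵛ c *ᵛ v) x                  ∎

  *ᵛ-assoc : ∀ {n} a b (v : 𝕍 n) → a *ᵛ (b *ᵛ v) ≡ (a * b) *ᵛ v
  *ᵛ-assoc a b v = vec-ext λ x → begin
    lookup (a *ᵛ (b *ᵛ v)) x  ≡⟨ lookup-*ᵛ a (b *ᵛ v) x ⟩
    a * lookup (b *ᵛ v) x     ≡⟨ cong (a *_) (lookup-*ᵛ b v x) ⟩
    a * (b * lookup v x)      ≡⟨ *-assoc a b _ ⟨
    a * b * lookup v x        ≡⟨ lookup-*ᵛ (a * b) v x ⟨
    lookup ((a * b) *ᵛ v) x   ∎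

  +ᵛ-inverseʳ : ∀ {n} (v : 𝕍 n) → v +ᵛ (-ᵛ v) ≡ 0ᵛ
  +ᵛ-inverseʳ v = vec-ext λ x → begin
    lookup (v +ᵛ (-ᵛ v)) x          ≡⟨ lookup-+ᵛ v _ x ⟩
    lookup v x + lookup (-ᵛ v) x    ≡⟨ cong (lookup v x +_) (trans (lookup-*ᵛ _ v x) (-1*x≈-x _)) ⟩
    lookup v x + - lookup v x       ≡⟨ -‿inverseʳ _ ⟩
    0#                              ≡⟨ lookup-0ᵛ x ⟨
    lookup 0ᵛ x                     ∎

  u+v-v≡u : ∀ {n} (u v : 𝕍 n) → (u +ᵛ v) +ᵛ (-ᵛ v) ≡ u
  u+v-v≡u u v = trans (+ᵛ-assoc u v _) (trans (cong (u +ᵛ_) (+ᵛ-inverseʳ v)) (+ᵛ-identityʳ u))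

  u-v+v≡u : ∀ {n} (u v : 𝕍 n) → (u +ᵛ (-ᵛ v)) +ᵛ v ≡ u
  u-v+v≡u u v = trans (+ᵛ-assoc u _ v) (trans (cong (u +ᵛ_) (trans (+ᵛ-comm _ v) (+ᵛ-inverseʳ v))) (+ᵛ-identityʳ u))

  u+v≡0⇒u≡-v : ∀ {n} {u v : 𝕍 n} → u +ᵛ v ≡ 0ᵛ → u ≡ -ᵛ v
  u+v≡0⇒u≡-v {u = u} {v} eq = trans (sym (u+v-v≡u u v)) (trans (cong (_+ᵛ (-ᵛ v)) eq) (+ᵛ-identityˡ _))

  u-v≡0⇒u≡v : ∀ {n} {u v : 𝕍 n} → u +ᵛ (-ᵛ v) ≡ 0ᵛ → u ≡ v
  u-v≡0⇒u≡v {u = u} {v} eq = trans (sym (u-v+v≡u u v)) (trans (cong (_+ᵛ v) eq) (+ᵛ-identityˡ v))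

  lin-cong : ∀ {n d} {c c′ : Vector F d} {b b′ : Vector (𝕍 n) d} → (∀ i → c i ≡ c′ i) → (∀ i → b i ≡ b′ i) → lin c b ≡ lin c′ b′
  lin-cong {c = c} {c′} {b} {b′} eq eq′ = vec-ext λ x → begin
    lookup (lin c b) x                   ≡⟨ lookup-lin c b x ⟩
    sum (λ i → c i * lookup (b i) x)     ≡⟨ sum-cong (λ i → cong₂ _*_ (eq i) (cong (λ v → lookup v x) (eq′ i))) ⟩
    sum (λ i → c′ i * lookup (b′ i) x)   ≡⟨ lookup-lin c′ b′ x ⟨
    lookup (lin c′ b′) x                 ∎

  lin-congˡ : ∀ {n d} {c c′ : Vector F d} (b : Vector (𝕍 n) d) → (∀ i → c i ≡ c′ i) → lin c b ≡ lin c′ b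
  lin-congˡ b eq = lin-cong eq (λ _ → refl)

  lin-zero : ∀ {n d} {c : Vector F d} (b : Vector (𝕍 n) d) → (∀ i → c i ≡ 0#) → lin c b ≡ 0ᵛ
  lin-zero {c = c} b eq = vec-ext λ x → trans (lookup-lin c b x)
    (trans (sum-zero (λ i → trans (cong (_* lookup (b i) x) (eq i)) (zeroˡ _))) (sym (lookup-0ᵛ x)))

  lin-+ : ∀ {n d} (c c′ : Vector F d) (b : Vector (𝕍 n) d) → lin (λ i → c i + c′ i) b ≡ lin c b +ᵛ lin c′ b
  lin-+ c c′ b = vec-ext λ x → begin
    lookup (lin (λ i → c i + c′ i) b) x                                      ≡⟨ lookup-lin _ b x ⟩
    sum (λ i → (c i + c′ i) * lookup (b i) x)                                ≡⟨ sum-cong (λ i → distribʳ _ (c i) (c′ i)) ⟩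
    sum (λ i → c i * lookup (b i) x + c′ i * lookup (b i) x)                 ≡⟨ sum-+ _ _ ⟩
    sum (λ i → c i * lookup (b i) x) + sum (λ i → c′ i * lookup (b i) x)     ≡⟨ cong₂ _+_ (lookup-lin c b x) (lookup-lin c′ b x) ⟨
    lookup (lin c b) x + lookup (lin c′ b) x                                 ≡⟨ lookup-+ᵛ (lin c b) (lin c′ b) x ⟨
    lookup (lin c b +ᵛ lin c′ b) x                                           ∎

  lin-* : ∀ {n d} a (c : Vector F d) (b : Vector (𝕍 n) d) → lin (λ i → a * c i) b ≡ a *ᵛ lin c b
  lin-* a c b = vec-ext λ x → begin
    lookup (lin (λ i → a * c i) b) x            ≡⟨ lookup-lin _ b x ⟩
    sum (λ i → a * c i * lookup (b i) x)        ≡⟨ sum-cong (λ i → *-assoc a (c i) _) ⟩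
    sum (λ i → a * (c i * lookup (b i) x))      ≡⟨ *-distribˡ-sum a _ ⟨
    a * sum (λ i → c i * lookup (b i) x)        ≡⟨ cong (a *_) (lookup-lin c b x) ⟨
    a * lookup (lin c b) x                      ≡⟨ lookup-*ᵛ a (lin c b) x ⟨
    lookup (a *ᵛ lin c b) x                     ∎

  lin-δ : ∀ {n d} (i : Fin d) (b : Vector (𝕍 n) d) → lin (δ i) b ≡ b i
  lin-δ i b = vec-ext λ x → trans (lookup-lin (δ i) b x) (sum-δ i _)

  -- Associativity of the product of a row, a matrix and a column, by exchanging the two sums.
  sum-*-assoc : ∀ {d e} (c : Vector F d) (C : Fin d → Fin e → F) (b : Vector F e) →
                sum (λ i → c i * sum (λ j → C i j * b j)) ≡ sum (λ j → sum (λ i → c i * C i j) * b j)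
  sum-*-assoc c C b = begin
    sum (λ i → c i * sum (λ j → C i j * b j))      ≡⟨ sum-cong (λ i → *-distribˡ-sum (c i) _) ⟩
    sum (λ i → sum (λ j → c i * (C i j * b j)))    ≡⟨ sum-comm _ ⟩
    sum (λ j → sum (λ i → c i * (C i j * b j)))    ≡⟨ sum-cong (λ j → sum-cong (λ i → sym (*-assoc (c i) (C i j) (b j)))) ⟩
    sum (λ j → sum (λ i → c i * C i j * b j))      ≡⟨ sum-cong (λ j → *-distribʳ-sum (b j) _) ⟨
    sum (λ j → sum (λ i → c i * C i j) * b j)      ∎

  lin-lin : ∀ {n d e} (c : Vector F d) (C : Fin d → Fin e → F) (b : Vector (𝕍 n) e) →
            lin c (λ i → lin (C i) b) ≡ lin (λ j → sum (λ i → c i * C i j)) b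
  lin-lin c C b = vec-ext λ x → begin
    lookup (lin c (λ i → lin (C i) b)) x                      ≡⟨ lookup-lin c _ x ⟩
    sum (λ i → c i * lookup (lin (C i) b) x)                  ≡⟨ sum-cong (λ i → cong (c i *_) (lookup-lin (C i) b x)) ⟩
    sum (λ i → c i * sum (λ j → C i j * lookup (b j) x))      ≡⟨ sum-*-assoc c C _ ⟩
    sum (λ j → sum (λ i → c i * C i j) * lookup (b j) x)      ≡⟨ lookup-lin _ b x ⟨
    lookup (lin (λ j → sum (λ i → c i * C i j)) b) x          ∎

  lin-↑ : ∀ {n} d {e} (c : Vector F (d ℕ.+ e)) (b : Vector (𝕍 n) (d ℕ.+ e)) →
          lin c b ≡ lin (λ i → c (i ↑ˡ e)) (λ i → b (i ↑ˡ e)) +ᵛ lin (λ j → c (d ↑ʳ j)) (λ j → b (d ↑ʳ j))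
  lin-↑ zero    c b = sym (+ᵛ-identityˡ _)
  lin-↑ (suc d) c b = trans (cong (c zero *ᵛ b zero +ᵛ_) (lin-↑ d (c ∘ suc) (b ∘ suc))) (sym (+ᵛ-assoc _ _ _))

  lin-combine : ∀ {n} r {j} (c : Vector F (r ℕ.* j)) (b : Vector (𝕍 n) (r ℕ.* j)) →
                lin c b ≡ vsum 𝔽 r (λ i → lin (λ l → c (combine i l)) (λ l → b (combine {r} i l)))
  lin-combine zero        c b = refl
  lin-combine (suc r) {j} c b = trans (lin-↑ j c b) (cong (lin (λ i → c (i ↑ˡ (r ℕ.* j))) (λ i → b (i ↑ˡ (r ℕ.* j))) +ᵛ_) (lin-combine r (λ x → c (j ↑ʳ x)) (λ x → b (j ↑ʳ x))))

  -- Spans and independence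

  module _ {n d} (b : Vector (𝕍 n) d) where

    span-0ᵛ : span b 0ᵛ
    span-0ᵛ = (λ _ → 0#) , sym (lin-zero b (λ _ → refl))

    span-+ᵛ : ∀ {u v} → span b u → span b v → span b (u +ᵛ v)
    span-+ᵛ (c , refl) (c′ , refl) = (λ i → c i + c′ i) , sym (lin-+ c c′ b)

    span-*ᵛ : ∀ a {v} → span b v → span b (a *ᵛ v)
    span-*ᵛ a (c , refl) = (λ i → a * c i) , sym (lin-* a c b)

    span-vsum : ∀ {e} {w : Vector (𝕍 n) e} → (∀ i → span b (w i)) → span b (vsum 𝔽 e w)
    span-vsum {zero}  w∈ = span-0ᵛ
    span-vsum {suc e} w∈ = span-+ᵛ (w∈ zero) (span-vsum (w∈ ∘ suc))

    span-lin : ∀ {e} (c : Vector F e) {w : Vector (𝕍 n) e} → (∀ i → span b (w i)) → span b (lin c w)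
    span-lin c w∈ = span-vsum (λ i → span-*ᵛ (c i) (w∈ i))

    span-generator : ∀ i → span b (b i)
    span-generator i = δ i , sym (lin-δ i b)

    span-cancelˡ : ∀ {u v} → span b u → span b (u +ᵛ v) → span b v
    span-cancelˡ {u} {v} u∈ u+v∈ = subst (span b) (trans (cong (_+ᵛ (-ᵛ u)) (+ᵛ-comm u v)) (u+v-v≡u v u)) (span-+ᵛ u+v∈ (span-*ᵛ (- 1#) u∈))

  span-mono : ∀ {n d e} {a : Vector (𝕍 n) d} {b : Vector (𝕍 n) e} → (∀ i → span b (a i)) → ∀ {v} → span a v → span b v
  span-mono {b = b} a⊆b (c , refl) = span-lin b c a⊆b

  -- Exhaustive search through the finite field, one coefficient at a time. It makes the case
  -- distinctions on membership constructive.
  span? : ∀ {n d} (b : Vector (𝕍 n) d) v → Dec (span b v)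
  span? {d = zero}  b v = Dec.map′ (λ eq → (λ ()) , eq) proj₂ (v ≟ᵛ 0ᵛ)
  span? {d = suc d} b v = Dec.map′
    (λ (x , c , eq) → (x VF.∷ c) , trans (sym (u-v+v≡u v (x *ᵛ b zero))) (trans (cong (_+ᵛ x *ᵛ b zero) eq) (+ᵛ-comm _ _)))
    (λ (c , eq) → c zero , c ∘ suc , trans (cong (_+ᵛ (-ᵛ (c zero *ᵛ b zero))) (trans eq (+ᵛ-comm _ _))) (u+v-v≡u _ _))
    (∃F? (λ x → span? (b ∘ suc) (v +ᵛ (-ᵛ (x *ᵛ b zero)))))

  -- Were the coefficient of `v` non-zero, dividing by it would put `v` into the span of `b`.
  indep-∷ : ∀ {n d} {b : Vector (𝕍 n) d} {v} → Indep b → ¬ span b v → Indep (v VF.∷ b)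
  indep-∷ {b = b} {v} b-indep v∉b c eq = λ { zero → c₀≡0 ; (suc i) → b-indep (c ∘ suc) tail≡0 i }
    where
    c₀≡0 : c zero ≡ 0#
    c₀≡0 with c zero ≟F 0#
    ... | yes c₀≡0 = c₀≡0
    ... | no  c₀≢0 with y , yc≡1 ← inv (c zero) c₀≢0 = ⊥-elim (v∉b (subst (span b) y*c₀v≡v (span-*ᵛ b y (subst (span b) (sym (u+v≡0⇒u≡-v eq)) (span-*ᵛ b _ (c ∘ suc , refl))))))
      where
      y*c₀v≡v : y *ᵛ (c zero *ᵛ v) ≡ v
      y*c₀v≡v = trans (*ᵛ-assoc y _ v) (trans (cong (_*ᵛ v) yc≡1) (*ᵛ-identityˡ v))
    tail≡0 : lin (c ∘ suc) b ≡ 0ᵛ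
    tail≡0 = trans (sym (trans (cong (_+ᵛ lin (c ∘ suc) b) (trans (cong (_*ᵛ v) c₀≡0) (*ᵛ-zeroˡ v))) (+ᵛ-identityˡ _))) eq

  -- Counting vectors by base-q digits, and dimension by counting

  encode : ∀ {d} → 𝕍 d → Fin (q ℕ.^ d)
  encode []      = zero
  encode (x ∷ v) = combine (index x) (encode v)

  decode : ∀ {d} → Fin (q ℕ.^ d) → 𝕍 d
  decode {zero}  _ = []
  decode {suc d} i = element (proj₁ (remQuot {q} (q ℕ.^ d) i)) ∷ decode (proj₂ (remQuot {q} (q ℕ.^ d) i))

  decode-encode : ∀ {d} (v : 𝕍 d) → decode (encode v) ≡ v
  decode-encode []      = refl
  decode-encode {suc d} (x ∷ v) = trans
    (cong (λ (i , j) → element i ∷ decode {d} j) (Finₚ.remQuot-combine (index x) (encode v)))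
    (cong₂ _∷_ (element-index x) (decode-encode v))

  encode-injective : ∀ {d} (u v : 𝕍 d) → encode u ≡ encode v → u ≡ v
  encode-injective u v eq = trans (sym (decode-encode u)) (trans (cong decode eq) (decode-encode v))

  decode-injective : ∀ {d} (i j : Fin (q ℕ.^ d)) → decode {d} i ≡ decode j → i ≡ j
  decode-injective {zero}  zero zero _ = refl
  decode-injective {suc d} i j eq = begin
    i                                           ≡⟨ Finₚ.combine-remQuot {q} (q ℕ.^ d) i ⟨
    uncurry combine (remQuot {q} (q ℕ.^ d) i)   ≡⟨ cong₂ combine
      (element-injective (Vecₚ.∷-injectiveˡ eq)) (decode-injective {d} _ _ (Vecₚ.∷-injectiveʳ eq)) ⟩
    uncurry combine (remQuot {q} (q ℕ.^ d) j)   ≡⟨ Finₚ.combine-remQuot {q} (q ℕ.^ d) j ⟩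
    j                                           ∎

  -- Pigeonhole in place of elimination: q^d ≤ q^e forces d ≤ e, as q > 1.
  injection⇒≤ : ∀ {d e} (f : 𝕍 d → 𝕍 e) → (∀ u v → f u ≡ f v → u ≡ v) → d ≤ e
  injection⇒≤ {d} {e} f f-inj = ℕₚ.≮⇒≥ λ e<d → ℕₚ.<⇒≱ (ℕₚ.^-monoʳ-< q 1<q e<d)
    (Finₚ.injective⇒≤ {f = encode ∘ f ∘ decode {d}} (λ eq → decode-injective {d} _ _ (f-inj _ _ (encode-injective _ _ eq))))

  -- Rewriting a combination of `a` in terms of `b` gives a map of coefficient vectors F^d → F^e.
  -- The vector itself can be recovered from its image, and by independence so can its coefficients.
  indep-≤ : ∀ {n d e} {a : Vector (𝕍 n) d} {b : Vector (𝕍 n) e} → Indep a → (∀ i → span b (a i)) → d ≤ e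
  indep-≤ {n} {d} {e} {a} {b} a-indep a⊆b = injection⇒≤ f f-injective
    where
    f : 𝕍 d → 𝕍 e
    f y = tabulate (λ j → sum (λ i → lookup y i * proj₁ (a⊆b i) j))
    f-lin : ∀ y → lin (lookup (f y)) b ≡ lin (lookup y) a
    f-lin y = begin
      lin (lookup (f y)) b                                          ≡⟨ lin-congˡ b (Vecₚ.lookup∘tabulate _) ⟩
      lin (λ j → sum (λ i → lookup y i * proj₁ (a⊆b i) j)) b        ≡⟨ lin-lin (lookup y) (proj₁ ∘ a⊆b) b ⟨
      lin (lookup y) (λ i → lin (proj₁ (a⊆b i)) b)                  ≡⟨ lin-cong (λ _ → refl) (λ i → sym (proj₂ (a⊆b i))) ⟩
      lin (lookup y) a                                              ∎
    f-injective : ∀ u v → f u ≡ f v → u ≡ v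
    f-injective u v eq = u-v≡0⇒u≡v (vec-ext λ x → trans (a-indep (lookup w) lin-w≡0 x) (sym (lookup-0ᵛ x)))
      where
      w : 𝕍 d
      w = u +ᵛ (-ᵛ v)
      lin-w≡0 : lin (lookup w) a ≡ 0ᵛ
      lin-w≡0 = begin
        lin (lookup w) a                                          ≡⟨ lin-congˡ a (λ i → trans (lookup-+ᵛ u (-ᵛ v) i) (cong (lookup u i +_) (lookup-*ᵛ (- 1#) v i))) ⟩
        lin (λ i → lookup u i + - 1# * lookup v i) a              ≡⟨ lin-+ _ _ a ⟩
        lin (lookup u) a +ᵛ lin (λ i → - 1# * lookup v i) a       ≡⟨ cong₂ _+ᵛ_ (trans (sym (f-lin u)) (trans (cong (λ y → lin (lookup y) b) eq) (f-lin v))) (lin-* (- 1#) (lookup v) a) ⟩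
        lin (lookup v) a +ᵛ (-ᵛ lin (lookup v) a)                 ≡⟨ +ᵛ-inverseʳ _ ⟩
        0ᵛ                                                        ∎

  -- A vector of span `b` outside span `a` would extend `a` to d + 1 > e independent vectors inside
  -- span `b`.
  spans-if-dim : ∀ {n d e} {a : Vector (𝕍 n) d} {b : Vector (𝕍 n) e} → Indep a → (∀ i → span b (a i)) → e ≤ d →
                 ∀ {v} → span b v → span a v
  spans-if-dim {a = a} {b} a-indep a⊆b e≤d {v} v∈b with span? a v
  ... | yes v∈a = v∈a
  ... | no  v∉a = ⊥-elim (ℕₚ.<⇒≱ (s≤s e≤d) (indep-≤ {a = v VF.∷ a} {b = b} (indep-∷ a-indep v∉a) λ { zero → v∈b ; (suc i) → a⊆b i }))

  -- Independence of the concatenation of `a` and `b`, phrased with two coefficient families so that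
  -- no index in d + e has to be split.
  IndepPair : ∀ {n d e} → Vector (𝕍 n) d → Vector (𝕍 n) e → Set
  IndepPair {d = d} {e} a b = (x : Vector F d) (y : Vector F e) → lin x a +ᵛ lin y b ≡ 0ᵛ → (∀ i → x i ≡ 0#) × (∀ j → y j ≡ 0#)

  splitIndex : ∀ {p} d {e} {P : Fin (d ℕ.+ e) → Set p} → (∀ i → P (i ↑ˡ e)) → (∀ j → P (d ↑ʳ j)) → ∀ i → P i
  splitIndex d {e} {P} l r i with Fin.splitAt d i in eq
  ... | inj₁ j = subst P (Finₚ.splitAt⁻¹-↑ˡ eq) (l j)
  ... | inj₂ j = subst P (Finₚ.splitAt⁻¹-↑ʳ eq) (r j)

  lin-++ : ∀ {n d e} (c : Vector F (d ℕ.+ e)) (a : Vector (𝕍 n) d) (b : Vector (𝕍 n) e) →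
           lin c (a VF.++ b) ≡ lin (λ i → c (i ↑ˡ e)) a +ᵛ lin (λ j → c (d ↑ʳ j)) b
  lin-++ {d = d} c a b = trans (lin-↑ d c (a VF.++ b))
    (cong₂ _+ᵛ_ (lin-cong (λ _ → refl) (VFₚ.lookup-++ˡ a b)) (lin-cong (λ _ → refl) (VFₚ.lookup-++ʳ a b)))

  indep-++ : ∀ {n d e} {a : Vector (𝕍 n) d} {b : Vector (𝕍 n) e} → IndepPair a b → Indep (a VF.++ b)
  indep-++ {d = d} {a = a} {b} ab c eq with l , r ← ab (λ i → c (i ↑ˡ _)) (λ j → c (d ↑ʳ j)) (trans (sym (lin-++ c a b)) eq) = splitIndex d l r

  indepPair-⊆ : ∀ {n d e f} {a : Vector (𝕍 n) d} {b : Vector (𝕍 n) e} {g : Vector (𝕍 n) f} →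
                IndepPair a b → (∀ i → span g (a i)) → (∀ i → span g (b i)) → d ℕ.+ e ≤ f
  indepPair-⊆ {d = d} {a = a} {b} {g} ab a⊆g b⊆g = indep-≤ {b = g} (indep-++ ab)
    (splitIndex d (λ i → subst (span g) (sym (VFₚ.lookup-++ˡ a b i)) (a⊆g i)) (λ j → subst (span g) (sym (VFₚ.lookup-++ʳ a b j)) (b⊆g j)))

  unit : ∀ {n} → Fin n → 𝕍 n
  unit i = tabulate (δ i)

  span-unit : ∀ {n} (v : 𝕍 n) → span unit v
  span-unit v = lookup v , vec-ext λ x → sym (begin
    lookup (lin (lookup v) unit) x               ≡⟨ lookup-lin (lookup v) unit x ⟩
    sum (λ i → lookup v i * lookup (unit i) x)   ≡⟨ sum-cong (λ i → cong (lookup v i *_) (Vecₚ.lookup∘tabulate (δ i) x)) ⟩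
    sum (λ i → lookup v i * δ i x)               ≡⟨ sum-δʳ x (lookup v) ⟩
    lookup v x                                   ∎)

  -- Functionals on F^n are given by vectors, through the dot product.

  dot : ∀ {n} → 𝕍 n → 𝕍 n → F
  dot u v = sum (λ x → lookup u x * lookup v x)

  dot-comm : ∀ {n} (u v : 𝕍 n) → dot u v ≡ dot v u
  dot-comm u v = sum-cong λ x → *-comm _ _

  dot-+ʳ : ∀ {n} (u v w : 𝕍 n) → dot u (v +ᵛ w) ≡ dot u v + dot u w
  dot-+ʳ u v w = trans (sum-cong λ x → trans (cong (lookup u x *_) (lookup-+ᵛ v w x)) (distribˡ _ _ _)) (sum-+ _ _)

  dot-*ʳ : ∀ {n} c (u v : 𝕍 n) → dot u (c *ᵛ v) ≡ c * dot u v
  dot-*ʳ c u v = trans (sum-cong λ x → trans (cong (lookup u x *_) (lookup-*ᵛ c v x)) (x*yz≡y*xz _ _ _)) (sym (*-distribˡ-sum c _))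

  dot-0ʳ : ∀ {n} (u : 𝕍 n) → dot u 0ᵛ ≡ 0#
  dot-0ʳ u = sum-zero λ x → trans (cong (lookup u x *_) (lookup-0ᵛ x)) (zeroʳ _)

  dot-linʳ : ∀ {n d} (u : 𝕍 n) (c : Vector F d) (b : Vector (𝕍 n) d) → dot u (lin c b) ≡ sum (λ i → c i * dot u (b i))
  dot-linʳ {d = zero}  u c b = trans (dot-0ʳ u) (sym (sum-[] _))
  dot-linʳ {d = suc d} u c b = trans (dot-+ʳ u (c zero *ᵛ b zero) (lin (c ∘ suc) (b ∘ suc)))
    (trans (cong₂ _+_ (dot-*ʳ (c zero) u (b zero)) (dot-linʳ u (c ∘ suc) (b ∘ suc))) (sym (sum-∷ _)))

  dot-vsum≡0 : ∀ {n d} (u : 𝕍 n) {w : Vector (𝕍 n) d} → (∀ i → dot u (w i) ≡ 0#) → dot u (vsum 𝔽 d w) ≡ 0#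
  dot-vsum≡0 {d = zero}  u w⊥ = dot-0ʳ u
  dot-vsum≡0 {d = suc d} u {w} w⊥ = trans (dot-+ʳ u (w zero) _) (trans (cong₂ _+_ (w⊥ zero) (dot-vsum≡0 u (w⊥ ∘ suc))) (+-identityˡ _))

  dot-span≡0 : ∀ {n d} (u : 𝕍 n) {b : Vector (𝕍 n) d} → (∀ i → dot u (b i) ≡ 0#) → ∀ {v} → span b v → dot u v ≡ 0#
  dot-span≡0 u {b} b⊥ (c , refl) = trans (dot-linʳ u c b) (sum-zero λ i → trans (cong (c i *_) (b⊥ i)) (zeroʳ _))

  dot-unitˡ : ∀ {n} x (v : 𝕍 n) → dot (unit x) v ≡ lookup v x
  dot-unitˡ x v = trans (sum-cong λ y → cong (_* lookup v y) (Vecₚ.lookup∘tabulate (δ x) y)) (sum-δ x (lookup v))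

  nonzero-coordinate : ∀ {n} (v : 𝕍 n) → v ≢ 0ᵛ → ∃[ x ] lookup v x ≢ 0#
  nonzero-coordinate v v≢0 = Finₚ.¬∀⟶∃¬ _ _ (λ x → lookup v x ≟F 0#) λ v≡0 → v≢0 (vec-ext λ x → trans (v≡0 x) (sym (lookup-0ᵛ x)))

  dot-+*ʳ : ∀ {n} (u v : 𝕍 n) c w → dot u (v +ᵛ c *ᵛ w) ≡ dot u v + c * dot u w
  dot-+*ʳ u v c w = trans (dot-+ʳ u v (c *ᵛ w)) (cong (dot u v +_) (dot-*ʳ c u w))

  dot-+*ˡ : ∀ {n} (u w : 𝕍 n) c v → dot (u +ᵛ c *ᵛ w) v ≡ dot u v + c * dot w v
  dot-+*ˡ u w c v = trans (dot-comm (u +ᵛ c *ᵛ w) v) (trans (dot-+*ʳ v u c w) (cong₂ (λ x y → x + c * y) (dot-comm v u) (dot-comm v w)))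

  x+-x*1≡0 : ∀ x → x + - x * 1# ≡ 0#
  x+-x*1≡0 x = trans (cong (x +_) (*-identityʳ _)) (-‿inverseʳ x)

  x+c*0≡x : ∀ {x c y} → y ≡ 0# → x + c * y ≡ x
  x+c*0≡x {x} {c} refl = trans (cong (x +_) (zeroʳ c)) (+-identityʳ x)

  -- If x is dual to f₁ … f_E, then g = f₀ − Σ (xᵢ·f₀) fᵢ is nonzero, so that y·g = 1 for a multiple y
  -- of a unit vector. Now x₀ = y − Σ (y·fᵢ) xᵢ is orthogonal to every fᵢ, and x₀·f₀ = y·g.
  dual : ∀ {n E} (f : Vector (𝕍 n) E) → Indep f → Σ (Vector (𝕍 n) E) λ x → ∀ i j → dot (x i) (f j) ≡ δ i j
  dual {E = zero}      f f-indep = f , λ ()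
  dual {n} {E = suc E} f f-indep with dual (f ∘ suc) tail-indep
    where
    tail-indep : Indep (f ∘ suc)
    tail-indep c eq i = f-indep (0# VF.∷ c) (trans (cong (_+ᵛ lin c (f ∘ suc)) (*ᵛ-zeroˡ (f zero))) (trans (+ᵛ-identityˡ _) eq)) (suc i)
  ... | x , x-dual = x₀ VF.∷ x₊ , x-dual′
    where
    f₀ : 𝕍 n
    f₀ = f zero
    h : Vector F (suc E)
    h = 1# VF.∷ λ i → - dot (x i) f₀
    g : 𝕍 n
    g = lin h f
    g≢0 : g ≢ 0ᵛ
    g≢0 g≡0 = 0≢1 (sym (f-indep h g≡0 zero))
    p : Fin n
    p = proj₁ (nonzero-coordinate g g≢0)
    c : F
    c = proj₁ (inv (lookup g p) (proj₂ (nonzero-coordinate g g≢0)))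
    y : 𝕍 n
    y = c *ᵛ unit p
    y·g≡1 : dot y g ≡ 1#
    y·g≡1 = begin
      dot y g                ≡⟨ dot-comm y g ⟩
      dot g (c *ᵛ unit p)    ≡⟨ dot-*ʳ c g (unit p) ⟩
      c * dot g (unit p)     ≡⟨ cong (c *_) (trans (dot-comm g (unit p)) (dot-unitˡ p g)) ⟩
      c * lookup g p         ≡⟨ proj₂ (inv (lookup g p) (proj₂ (nonzero-coordinate g g≢0))) ⟩
      1#                     ∎
    x₀ : 𝕍 n
    x₀ = y +ᵛ lin (λ i → - dot y (f (suc i))) x
    x₀·f : ∀ v → dot x₀ v ≡ dot y v + sum (λ i → - dot y (f (suc i)) * dot (x i) v)
    x₀·f v = begin
      dot x₀ v                                                        ≡⟨ dot-comm x₀ v ⟩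
      dot v x₀                                                        ≡⟨ dot-+ʳ v y _ ⟩
      dot v y + dot v (lin (λ i → - dot y (f (suc i))) x)             ≡⟨ cong₂ _+_ (dot-comm v y) (dot-linʳ v _ x) ⟩
      dot y v + sum (λ i → - dot y (f (suc i)) * dot v (x i))         ≡⟨ cong (dot y v +_) (sum-cong λ i → cong (- dot y (f (suc i)) *_) (dot-comm v (x i))) ⟩
      dot y v + sum (λ i → - dot y (f (suc i)) * dot (x i) v)         ∎
    x₀-f₀ : dot x₀ f₀ ≡ 1#
    x₀-f₀ = begin
      dot x₀ f₀                                                           ≡⟨ x₀·f f₀ ⟩
      dot y f₀ + sum (λ i → - dot y (f (suc i)) * dot (x i) f₀)           ≡⟨ cong₂ _+_ (sym (*-identityˡ _)) (sum-cong λ i → swap-sign (dot y (f (suc i))) (dot (x i) f₀)) ⟩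
      1# * dot y f₀ + sum (λ i → - dot (x i) f₀ * dot y (f (suc i)))      ≡⟨ sum-∷ (λ i → h i * dot y (f i)) ⟨
      sum (λ i → h i * dot y (f i))          ≡⟨ dot-linʳ y h f ⟨
      dot y g                                                             ≡⟨ y·g≡1 ⟩
      1#                                                                  ∎
      where
      swap-sign : ∀ a b → - a * b ≡ - b * a
      swap-sign a b = trans (sym (-‿distribˡ-* a b)) (trans (cong -_ (*-comm a b)) (-‿distribˡ-* b a))
    x₀-f₊ : ∀ j → dot x₀ (f (suc j)) ≡ 0#
    x₀-f₊ j = begin
      dot x₀ (f (suc j))                                                                ≡⟨ x₀·f (f (suc j)) ⟩
      dot y (f (suc j)) + sum (λ i → - dot y (f (suc i)) * dot (x i) (f (suc j)))       ≡⟨ cong (dot y (f (suc j)) +_) (sum-cong λ i → cong (- dot y (f (suc i)) *_) (x-dual i j)) ⟩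
      dot y (f (suc j)) + sum (λ i → - dot y (f (suc i)) * δ i j)                       ≡⟨ cong (dot y (f (suc j)) +_) (sum-δʳ j _) ⟩
      dot y (f (suc j)) + - dot y (f (suc j))                                           ≡⟨ -‿inverseʳ _ ⟩
      0#                                                                                ∎
    -- Adding a multiple of x₀ cancels the product with f₀ and keeps the other products, since x₀ is
    -- orthogonal to f₁ ... f_E.
    x₊ : Vector (𝕍 n) E
    x₊ i = x i +ᵛ (- dot (x i) f₀) *ᵛ x₀
    x-dual′ : ∀ i j → dot ((x₀ VF.∷ x₊) i) (f j) ≡ δ i j
    x-dual′ zero    zero    = x₀-f₀
    x-dual′ zero    (suc j) = x₀-f₊ j
    x-dual′ (suc i) zero    = trans (dot-+*ˡ (x i) x₀ _ f₀) (trans (cong (λ z → dot (x i) f₀ + - dot (x i) f₀ * z) x₀-f₀) (x+-x*1≡0 _))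
    x-dual′ (suc i) (suc j) = trans (dot-+*ˡ (x i) x₀ _ (f (suc j))) (trans (x+c*0≡x (x₀-f₊ j)) (x-dual i j))

  -- Vectors dual to `f` are independent of `v`: the product with f_e kills every combination of `v`
  -- and reads off the e-th coefficient of the dual part. So D + E independent vectors fit into F^n.
  annihilator-dim : ∀ {n D E} (v : Vector (𝕍 n) D) (f : Vector (𝕍 n) E) → Indep v → Indep f →
                    (∀ e i → dot (f e) (v i) ≡ 0#) → D ℕ.+ E ≤ n
  annihilator-dim {n} v f v-indep f-indep f⊥v = indepPair-⊆ {g = unit} pair (λ i → span-unit (v i)) (λ i → span-unit (x i))
    where
    x : Vector (𝕍 n) _
    x = proj₁ (dual f f-indep)
    pair : IndepPair v x
    pair c y eq = v-indep c c·v≡0 , y≡0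
      where
      y≡0 : ∀ e → y e ≡ 0#
      y≡0 e = begin
        y e                                               ≡⟨ sum-δʳ e y ⟨
        sum (λ i → y i * δ i e)                           ≡⟨ sum-cong (λ i → cong (y i *_) (trans (sym (proj₂ (dual f f-indep) i e)) (dot-comm (x i) (f e)))) ⟩
        sum (λ i → y i * dot (f e) (x i))                 ≡⟨ dot-linʳ (f e) y x ⟨
        dot (f e) (lin y x)                               ≡⟨ +-identityˡ _ ⟨
        0# + dot (f e) (lin y x)                          ≡⟨ cong (_+ dot (f e) (lin y x)) (dot-span≡0 (f e) {v} (f⊥v e) (c , refl)) ⟨
        dot (f e) (lin c v) + dot (f e) (lin y x)         ≡⟨ dot-+ʳ (f e) (lin c v) (lin y x) ⟨
        dot (f e) (lin c v +ᵛ lin y x)                    ≡⟨ cong (dot (f e)) eq ⟩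
        dot (f e) 0ᵛ                                      ≡⟨ dot-0ʳ (f e) ⟩
        0#                                                ∎
      c·v≡0 : lin c v ≡ 0ᵛ
      c·v≡0 = trans (sym (trans (cong (lin c v +ᵛ_) (lin-zero x y≡0)) (+ᵛ-identityʳ _))) eq

  allVecs : ∀ d → List (𝕍 d)
  allVecs d = List.tabulate (decode {d})

  length-allVecs : ∀ d → length (allVecs d) ≡ q ℕ.^ d
  length-allVecs d = Listₚ.length-tabulate (decode {d})

  ∈-allVecs : ∀ {d} (v : 𝕍 d) → v ∈ allVecs d
  ∈-allVecs v = subst (_∈ allVecs _) (decode-encode v) (∈ₚ.∈-tabulate⁺ (encode v))

  allVecs-unique : ∀ d → Unique (allVecs d)
  allVecs-unique d = Uniqueₚ.tabulate⁺ (decode-injective {d} _ _)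

-- Upper bound: points, complements and blocks

module UpperBound {q} (𝔽 : FiniteField q) where
  open LinearAlgebra 𝔽
  open ≡-Reasoning

  -- One vector on each line of the span of an independent family t.
  points : ∀ {n D} → Vector (𝕍 n) D → List (𝕍 n)
  points {D = zero}  t = []
  points {D = suc D} t = List.map (λ c → t zero +ᵛ lin (lookup c) (t ∘ suc)) (allVecs D) List.++ points (t ∘ suc)

  length-points : ∀ {n D} (t : Vector (𝕍 n) D) → length (points t) ≡ [ D ] q
  length-points {D = zero}  t = refl
  length-points {D = suc D} t = trans (Listₚ.length-++ (List.map _ (allVecs D)))
    (cong₂ ℕ._+_ (trans (Listₚ.length-map _ (allVecs D)) (length-allVecs D)) (length-points (t ∘ suc)))

  -- Scaling the first non-zero coefficient to 1 turns the combination into one of the listed points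
  -- without leaving the span of `b`.
  points-meet : ∀ {n D e} (b : Vector (𝕍 n) e) (t : Vector (𝕍 n) D) (c : Vector F D) → span b (lin c t) →
                (∀ i → c i ≡ 0#) ⊎ Any (span b) (points t)
  points-meet {D = zero}      b t c c∈b = inj₁ λ ()
  points-meet {n} {D = suc D} b t c c∈b with c zero ≟F 0#
  ... | yes c₀≡0 = Sum.map (λ { eq zero → c₀≡0 ; eq (suc i) → eq i }) (Anyₚ.++⁺ʳ _)
    (points-meet b (t ∘ suc) (c ∘ suc) (subst (span b) (trans (cong (_+ᵛ lin (c ∘ suc) (t ∘ suc)) (trans (cong (_*ᵛ t zero) c₀≡0) (*ᵛ-zeroˡ (t zero)))) (+ᵛ-identityˡ _)) c∈b))
  ... | no  c₀≢0 with y , yc₀≡1 ← inv (c zero) c₀≢0 =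
    inj₂ (Anyₚ.++⁺ˡ (Anyₚ.map⁺ (lose (∈-allVecs (tabulate (λ i → y * c (suc i)))) (subst (span b) eq (span-*ᵛ b y c∈b)))))
    where
    eq : y *ᵛ lin c t ≡ t zero +ᵛ lin (lookup (tabulate (λ i → y * c (suc i)))) (t ∘ suc)
    eq = begin
      y *ᵛ (c zero *ᵛ t zero +ᵛ lin (c ∘ suc) (t ∘ suc))             ≡⟨ *ᵛ-distribˡ y (c zero *ᵛ t zero) _ ⟩
      y *ᵛ c zero *ᵛ t zero +ᵛ y *ᵛ lin (c ∘ suc) (t ∘ suc)          ≡⟨ cong₂ _+ᵛ_
        (trans (*ᵛ-assoc y (c zero) (t zero)) (trans (cong (_*ᵛ t zero) yc₀≡1) (*ᵛ-identityˡ (t zero))))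
        (trans (sym (lin-* y (c ∘ suc) (t ∘ suc))) (lin-congˡ (t ∘ suc) (λ i → sym (Vecₚ.lookup∘tabulate _ i)))) ⟩
      t zero +ᵛ lin (lookup (tabulate (λ i → y * c (suc i)))) (t ∘ suc) ∎

  -- The coefficient 1 certifies that a point is not zero, in the form in which `indep-point` uses
  -- it.
  points-normalised : ∀ {n D} (t : Vector (𝕍 n) D) {p} → p ∈ points t → Σ (Vector F D) λ c → p ≡ lin c t × ∃[ i ] c i ≡ 1#
  points-normalised {D = suc D} t p∈ with ∈ₚ.∈-++⁻ (List.map _ (allVecs D)) p∈
  ... | inj₁ p∈ˡ with c , _ , refl ← ∈ₚ.∈-map⁻ _ p∈ˡ =
    (1# VF.∷ lookup c) , cong (_+ᵛ lin (lookup c) (t ∘ suc)) (sym (*ᵛ-identityˡ (t zero))) , zero , refl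
  ... | inj₂ p∈ʳ with c , refl , i , cᵢ≡1 ← points-normalised (t ∘ suc) p∈ʳ =
    (0# VF.∷ c) , sym (trans (cong (_+ᵛ lin c (t ∘ suc)) (*ᵛ-zeroˡ (t zero))) (+ᵛ-identityˡ _)) , suc i , cᵢ≡1

  indep-point : ∀ {n d D} {K : Vector (𝕍 n) d} {t : Vector (𝕍 n) D} → IndepPair K t → ∀ {p} → p ∈ points t → Indep (p VF.∷ K)
  indep-point {K = K} {t} Kt p∈ z eq with c , refl , i , cᵢ≡1 ← points-normalised t p∈
    with z₊≡0 , z₀c≡0 ← Kt (z ∘ suc) (λ i → z zero * c i) (trans (cong (lin (z ∘ suc) K +ᵛ_) (lin-* (z zero) c t)) (trans (+ᵛ-comm (lin (z ∘ suc) K) _) eq)) =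
    λ { zero → trans (sym (*-identityʳ _)) (trans (cong (z zero *_) (sym cᵢ≡1)) (z₀c≡0 i)) ; (suc j) → z₊≡0 j }

  -- As long as d < k, some vector of the basis `b` lies outside span `K` by dimension; it joins
  -- both `K` and the complement under construction.
  extend : ∀ {n k} {b : Vector (𝕍 n) k} → Indep b → ∀ j {d} {K : Vector (𝕍 n) d} → Indep K → (∀ x → span b (K x)) → d ℕ.+ j ≡ k →
           Σ (Vector (𝕍 n) j) λ e → (∀ l → span b (e l)) × IndepPair K e
  extend b-indep zero {K = K} K-indep K⊆b eq = (λ ()) , (λ ()) , λ x y xK≡0 → K-indep x (trans (sym (+ᵛ-identityʳ _)) xK≡0) , λ ()
  extend {b = b} b-indep (suc j) {d} {K} K-indep K⊆b eq
    with i , bᵢ∉K ← Finₚ.¬∀⟶∃¬ _ _ (λ i → span? K (b i))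
                      (λ b⊆K → ℕₚ.<⇒≱ (subst (d <_) eq (ℕₚ.m<m+n d (s≤s z≤n))) (indep-≤ {b = K} b-indep b⊆K))
    with e , e⊆b , Ke ← extend b-indep j {K = b i VF.∷ K} (indep-∷ K-indep bᵢ∉K)
                          (λ { zero → span-generator b i ; (suc x) → K⊆b x }) (trans (sym (ℕₚ.+-suc d j)) eq) =
    (b i VF.∷ e) , (λ { zero → span-generator b i ; (suc l) → e⊆b l }) , pair
    where
    pair : IndepPair K (b i VF.∷ e)
    pair x y eq′ with l , r ← Ke (y zero VF.∷ x) (y ∘ suc) (trans (cong (_+ᵛ lin (y ∘ suc) e) (+ᵛ-comm (y zero *ᵛ b i) (lin x K))) (trans (+ᵛ-assoc (lin x K) _ _) eq′)) =
      (λ i → l (suc i)) , λ { zero → l zero ; (suc j) → r j }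

  -- In a vanishing combination the part from `T` equals minus a vector of span `b`. As span `b`
  -- contains no point of `T`, that part has zero coefficients, and what remains concerns only `K`
  -- and `a`.
  indepPair-++ : ∀ {n k d e D} (b : Vector (𝕍 n) k) {K : Vector (𝕍 n) d} {a : Vector (𝕍 n) e} {T : Vector (𝕍 n) D} →
                 (∀ x → span b (K x)) → (∀ x → span b (a x)) → IndepPair K a → ¬ Any (span b) (points T) → IndepPair K (a VF.++ T)
  indepPair-++ {d = d} {e} {D} b {K} {a} {T} K⊆b a⊆b Ka b∩T x y eq = proj₁ xy₁≡0 , splitIndex e (proj₂ xy₁≡0) y₂≡0
    where
    y₁ : Vector F e
    y₁ l = y (l ↑ˡ D)
    y₂ : Vector F D
    y₂ l = y (e ↑ʳ l)
    eq′ : (lin x K +ᵛ lin y₁ a) +ᵛ lin y₂ T ≡ 0ᵛ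
    eq′ = trans (+ᵛ-assoc (lin x K) (lin y₁ a) (lin y₂ T)) (trans (cong (lin x K +ᵛ_) (sym (lin-++ y a T))) eq)
    y₂∈b : span b (lin y₂ T)
    y₂∈b = span-cancelˡ b (span-+ᵛ b (span-lin b x K⊆b) (span-lin b y₁ a⊆b)) (subst (span b) (sym eq′) (span-0ᵛ b))
    y₂≡0 : ∀ l → y₂ l ≡ 0#
    y₂≡0 = Sum.fromInj₁ (⊥-elim ∘ b∩T) (points-meet b T y₂ y₂∈b)
    xy₁≡0 : (∀ t → x t ≡ 0#) × (∀ l → y₁ l ≡ 0#)
    xy₁≡0 = Ka x y₁ (trans (sym (trans (cong ((lin x K +ᵛ lin y₁ a) +ᵛ_) (lin-zero T y₂≡0)) (+ᵛ-identityʳ _))) eq′)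

  block : ∀ {A : Set} {r j} → Vector A (r ℕ.* j) → Fin r → Vector A j
  block {r = r} T i l = T (combine {r} i l)

  -- Extension of `y` by zero outside block `i`, through which the independence of all of `T`
  -- applies to single blocks.
  place : ∀ {r j} → Fin r → Vector F j → Vector F (r ℕ.* j)
  place {r} {j} i y z = δ i (proj₁ (remQuot {r} j z)) * y (proj₂ (remQuot {r} j z))

  place-combine : ∀ {r j} (i : Fin r) (y : Vector F j) i′ l → place i y (combine i′ l) ≡ δ i i′ * y l
  place-combine i y i′ l = cong (λ (a , b) → δ i a * y b) (Finₚ.remQuot-combine i′ l)

  vsum-cong : ∀ {n d} {w w′ : Vector (𝕍 n) d} → (∀ i → w i ≡ w′ i) → vsum 𝔽 d w ≡ vsum 𝔽 d w′
  vsum-cong {d = zero}  eq = refl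
  vsum-cong {d = suc d} eq = cong₂ _+ᵛ_ (eq zero) (vsum-cong (eq ∘ suc))

  lin-place : ∀ {n r j} i (y : Vector F j) (T : Vector (𝕍 n) (r ℕ.* j)) → lin (place {r} i y) T ≡ lin y (block {r = r} T i)
  lin-place {r = r} i y T = begin
    lin (place {r} i y) T                                                    ≡⟨ lin-combine r (place {r} i y) T ⟩
    vsum 𝔽 r (λ i′ → lin (λ l → place i y (combine i′ l)) (block T i′))      ≡⟨ vsum-cong (λ i′ → trans (lin-congˡ (block T i′) (place-combine i y i′)) (lin-* (δ i i′) y (block T i′))) ⟩
    lin (δ i) (λ i′ → lin y (block T i′))                                    ≡⟨ lin-δ i (λ i′ → lin y (block {r = r} T i′)) ⟩
    lin y (block T i)                                                        ∎

  module _ {n d r j} {K : Vector (𝕍 n) d} {T : Vector (𝕍 n) (r ℕ.* j)} (KT : IndepPair K T) where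

    indep-block : ∀ i → IndepPair K (block {r = r} T i)
    indep-block i x y eq with l , r′ ← KT x (place {r} i y) (trans (cong (lin x K +ᵛ_) (lin-place {r = r} i y T)) eq) =
      l , λ l′ → trans (sym (*-identityˡ _)) (trans (cong (_* y l′) (sym (δ-refl i))) (trans (sym (place-combine i y i l′)) (r′ (combine i l′))))

    -- In the difference of the two sides, the coefficients on block `i` are those of `y` alone, and
    -- independence makes them vanish. Hence two chosen members meet only in span `K`.
    blocks-disjoint : ∀ {i i′} → i ≢ i′ → ∀ x y x′ y′ →
                      lin x K +ᵛ lin y (block {r = r} T i) ≡ lin x′ K +ᵛ lin y′ (block {r = r} T i′) → ∀ l → y l ≡ 0#
    blocks-disjoint {i} {i′} i≢i′ x y x′ y′ eq l = begin
      y l                                                              ≡⟨ x+c*0≡x {c = - 1#} (trans (cong (_* y′ l) (δ-≢ (i≢i′ ∘ sym))) (zeroˡ _)) ⟨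
      y l + - 1# * (δ i′ i * y′ l)                                     ≡⟨ cong (_+ - 1# * (δ i′ i * y′ l)) (trans (cong (_* y l) (δ-refl i)) (*-identityˡ _)) ⟨
      δ i i * y l + - 1# * (δ i′ i * y′ l)                             ≡⟨ cong₂ (λ a b → a + - 1# * b) (place-combine i y i l) (place-combine i′ y′ i l) ⟨
      place i y (combine i l) + - 1# * place i′ y′ (combine i l)       ≡⟨ proj₂ (KT (λ t → x t + - 1# * x′ t) (λ z → place {r} i y z + - 1# * place {r} i′ y′ z) sum≡0) (combine i l) ⟩
      0#                                                               ∎
      where
      X  = lin x K
      X′ = lin x′ K
      Y  = lin y (block {r = r} T i)
      Y′ = lin y′ (block {r = r} T i′)
      split : ∀ {e} (u v : Vector F e) (b : Vector (𝕍 n) e) → lin (λ i → u i + - 1# * v i) b ≡ lin u b +ᵛ (-ᵛ lin v b)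
      split u v b = trans (lin-+ u _ b) (cong (lin u b +ᵛ_) (lin-* (- 1#) v b))
      sum≡0 : lin (λ t → x t + - 1# * x′ t) K +ᵛ lin (λ z → place {r} i y z + - 1# * place {r} i′ y′ z) T ≡ 0ᵛ
      sum≡0 = begin
        lin (λ t → x t + - 1# * x′ t) K +ᵛ lin (λ z → place {r} i y z + - 1# * place {r} i′ y′ z) T
          ≡⟨ cong₂ _+ᵛ_ (split x x′ K) (trans (split (place {r} i y) (place {r} i′ y′) T) (cong₂ (λ a b → a +ᵛ (-ᵛ b)) (lin-place {r = r} i y T) (lin-place {r = r} i′ y′ T))) ⟩
        (X +ᵛ (-ᵛ X′)) +ᵛ (Y +ᵛ (-ᵛ Y′))
          ≡⟨ +ᵛ-interchange X (-ᵛ X′) Y (-ᵛ Y′) ⟩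
        (X +ᵛ Y) +ᵛ ((-ᵛ X′) +ᵛ (-ᵛ Y′))
          ≡⟨ cong₂ _+ᵛ_ eq (sym (*ᵛ-distribˡ (- 1#) X′ Y′)) ⟩
        (X′ +ᵛ Y′) +ᵛ (-ᵛ (X′ +ᵛ Y′))
          ≡⟨ +ᵛ-inverseʳ _ ⟩
        0ᵛ ∎

  -- Upper bound: greedy choice and induction for a sunflower-free family

  module Family {n m k s′} (𝓕 : Fin m → Pred 𝔽 n) (family : IsFamilyOfKSpaces 𝔽 k 𝓕) (free : SunflowerFree 𝔽 (suc s′) k 𝓕) where

    s : ℕ
    s = suc s′

    basis : Fin m → Vector (𝕍 n) k
    basis i = proj₁ (proj₁ family i)

    basis-indep : ∀ i → Indep (basis i)
    basis-indep i = proj₁ (proj₂ (proj₁ family i))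

    to : ∀ {i v} → 𝓕 i v → span (basis i) v
    to {i} {v} = proj₁ (proj₂ (proj₂ (proj₁ family i)) v)

    from : ∀ {i v} → span (basis i) v → 𝓕 i v
    from {i} {v} = proj₂ (proj₂ (proj₂ (proj₁ family i)) v)

    _⊑_ : ∀ {d} → Vector (𝕍 n) d → Fin m → Set
    K ⊑ i = ∀ x → span (basis i) (K x)

    module Step {d j} {K : Vector (𝕍 n) d} (K-indep : Indep K) (d+j≡k : d ℕ.+ suc j ≡ k) where

      -- The members ι i are in general position modulo K; block i of T spans a complement of K in ι i.
      record Chosen (r : ℕ) : Set where
        field
          ι     : Fin r → Fin m
          K⊑    : ∀ i → K ⊑ ι i
          T     : Vector (𝕍 n) (r ℕ.* suc j)
          T⊑    : ∀ i → block {r = r} T i ⊑ ι i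
          indep : IndepPair K T

        -- `K` and block `i` are d + (j + 1) = k independent vectors in a k-space, hence a basis of
        -- it.
        span-block : ∀ i {v} → span (basis (ι i)) v → span (K VF.++ block {r = r} T i) v
        span-block i = spans-if-dim {a = K VF.++ block {r = r} T i} {b = basis (ι i)} (indep-++ (indep-block {r = r} indep i))
          (splitIndex d (λ x → subst (span _) (sym (VFₚ.lookup-++ˡ K (block {r = r} T i) x)) (K⊑ i x))
                        (λ x → subst (span _) (sym (VFₚ.lookup-++ʳ K (block {r = r} T i) x)) (T⊑ i x)))
          (ℕₚ.≤-reflexive (sym d+j≡k))

        coordinates : ∀ i {v} → span (basis (ι i)) v → ∃[ x ] ∃[ y ] v ≡ lin x K +ᵛ lin y (block {r = r} T i)
        coordinates i v∈ = let c , eq = span-block i v∈ in (λ x → c (x ↑ˡ suc j)) , (λ l → c (d ↑ʳ l)) , trans eq (lin-++ c K (block {r = r} T i))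

        -- If a member were chosen twice, the first vector of one block would be a combination of
        -- `K` and the other block, against `blocks-disjoint`. A first vector exists because blocks
        -- have length `suc j`.
        ι-injective : ∀ i i′ → ι i ≡ ι i′ → i ≡ i′
        ι-injective i i′ eq = Dec.decidable-stable (i Fin.≟ i′) λ i≢i′ →
          let x , y , eq′ = coordinates i′ (subst (λ z → span (basis z) (block {r = r} T i zero)) eq (T⊑ i zero)) in
          0≢1 (sym (blocks-disjoint {r = r} {K = K} indep i≢i′ (λ _ → 0#) (δ zero) x y
            (trans (cong₂ _+ᵛ_ (lin-zero K (λ _ → refl)) (lin-δ zero (block {r = r} T i))) (trans (+ᵛ-identityˡ _) eq′)) zero))

        ∩⊆K : ∀ i i′ → i ≢ i′ → ∀ {v} → span (basis (ι i)) v → span (basis (ι i′)) v → span K v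
        ∩⊆K i i′ i≢i′ v∈ v∈′ =
          let x  , y  , eq  = coordinates i v∈
              x′ , y′ , eq′ = coordinates i′ v∈′
          in x , trans eq (trans (cong (lin x K +ᵛ_) (lin-zero (block {r = r} T i) (blocks-disjoint {r = r} indep i≢i′ x y x′ y′ (trans (sym eq) eq′)))) (+ᵛ-identityʳ _))

      chosen₀ : Chosen 0
      chosen₀ = record { ι = λ () ; K⊑ = λ () ; T = λ () ; T⊑ = λ () ; indep = λ x y eq → K-indep x (trans (sym (+ᵛ-identityʳ _)) eq) , λ () }

      -- The new block is a complement of `K` in member `i`; general position persists because this
      -- member avoids all points of `T`.
      chooseNext : ∀ {r} (C : Chosen r) {i} → K ⊑ i → ¬ Any (span (basis i)) (points (Chosen.T C)) → Chosen (suc r)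
      chooseNext {r} C {i} K⊑i i∩T = record
        { ι     = i VF.∷ ι
        ; K⊑    = λ { zero → K⊑i ; (suc i) → K⊑ i }
        ; T     = e VF.++ T
        ; T⊑    = λ { zero l → subst (span (basis i)) (sym (VFₚ.lookup-++ˡ e T l)) (e⊑i l)
                    ; (suc i) l → subst (span (basis (ι i))) (sym (VFₚ.lookup-++ʳ e T (combine {r} i l))) (T⊑ i l) }
        ; indep = indepPair-++ (basis i) K⊑i e⊑i (proj₂ (proj₂ extension)) i∩T
        }
        where
        open Chosen C
        extension : Σ (Vector (𝕍 n) (suc j)) λ e → e ⊑ i × IndepPair K e
        extension = extend (basis-indep i) (suc j) K-indep K⊑i d+j≡k
        e : Vector (𝕍 n) (suc j)
        e = proj₁ extension
        e⊑i : e ⊑ i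
        e⊑i = proj₁ (proj₂ extension)

      -- Such a choice is a sunflower with kernel span `K`: `blocks-disjoint` gives the
      -- intersections, and `K` followed by `T` is a basis of the sum.
      ¬chosen-s : ¬ Chosen s
      ¬chosen-s C = free ι ι-injective
        ( (λ i → proj₁ family (ι i))
        , (λ i i′ i≢i′ → proj₂ family (ι i) (ι i′) (i≢i′ ∘ ι-injective i i′))
        , d , span K , (K , K-indep , λ v → id , id)
        , (λ i i′ i≢i′ v → (λ v∈K → from (span-mono (K⊑ i) v∈K) , from (span-mono (K⊑ i′) v∈K)) , λ (v∈ , v∈′) → ∩⊆K i i′ i≢i′ (to v∈) (to v∈′))
        , subst (λ x → IsSubspaceOfDim 𝔽 (d ℕ.+ s ℕ.* x) (SumOf 𝔽 s (λ i → 𝓕 (ι i)))) (sym k∸d≡j)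
            (K VF.++ T , indep-++ indep , λ v → sum⊆span , span⊆sum) )
        where
        open Chosen C
        k∸d≡j : k ℕ.∸ d ≡ suc j
        k∸d≡j = trans (cong (ℕ._∸ d) (sym d+j≡k)) (ℕₚ.m+n∸m≡n d (suc j))
        generatorˡ : ∀ x → span (K VF.++ T) (K x)
        generatorˡ x = subst (span _) (VFₚ.lookup-++ˡ K T x) (span-generator (K VF.++ T) (x ↑ˡ _))
        generatorʳ : ∀ x → span (K VF.++ T) (T x)
        generatorʳ x = subst (span _) (VFₚ.lookup-++ʳ K T x) (span-generator (K VF.++ T) (d ↑ʳ x))
        sum⊆span : ∀ {v} → SumOf 𝔽 s (λ i → 𝓕 (ι i)) v → span (K VF.++ T) v
        sum⊆span (w , w∈ , refl) = span-vsum (K VF.++ T) member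
          where
          member : ∀ i → span (K VF.++ T) (w i)
          member i = let x , y , eq = coordinates i (to (w∈ i)) in
            subst (span _) (sym eq) (span-+ᵛ (K VF.++ T) (span-lin (K VF.++ T) x generatorˡ) (span-lin (K VF.++ T) y (λ l → generatorʳ (combine {s} i l))))
        span⊆sum : ∀ {v} → span (K VF.++ T) v → SumOf 𝔽 s (λ i → 𝓕 (ι i)) v
        span⊆sum (c , refl) = w , w∈ , trans (lin-++ c K T) (trans (cong (lin x K +ᵛ_) (lin-combine s y T)) (sym (+ᵛ-assoc (lin x K) (part zero) _)))
          where
          x : Vector F d
          x t = c (t ↑ˡ (s ℕ.* suc j))
          y : Vector F (s ℕ.* suc j)
          y z = c (d ↑ʳ z)
          part : Vector (𝕍 n) s
          part i = lin (block {r = s} y i) (block {r = s} T i)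
          part∈ : ∀ i → span (basis (ι i)) (part i)
          part∈ i = span-lin (basis (ι i)) (block {r = s} y i) (T⊑ i)
          w : Vector (𝕍 n) s
          -- The kernel part of a vector of the sum must be assigned to one summand; the first takes
          -- it.
          w zero    = lin x K +ᵛ part zero
          w (suc i) = part (suc i)
          w∈ : ∀ i → 𝓕 (ι i) (w i)
          w∈ zero    = from (span-+ᵛ (basis (ι zero)) (span-lin (basis (ι zero)) x (K⊑ zero)) (part∈ zero))
          w∈ (suc i) = from (part∈ (suc i))

      module _ {N xs} (xs! : Unique xs) (K⊑xs : All (K ⊑_) xs)
               (bound : ∀ {p} → Indep (p VF.∷ K) → ∀ {ys} → Unique ys → All ((p VF.∷ K) ⊑_) ys → length ys ≤ N) where

        -- `f` counts the members still missing from a sunflower. Either every listed member meets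
        -- the points of `T`, and counting by points ends the search, or one that does not is chosen
        -- next.
        greedy : ∀ f {r} → f ℕ.+ r ≡ s → Chosen r → length xs ≤ N ℕ.* [ suc j ℕ.* s′ ] q
        greedy zero        refl C = ⊥-elim (¬chosen-s C)
        greedy (suc f) {r} eq   C = Sum.[ meet⇒bound , ¬meet⇒bound ]′ (Dec.toSum (All.all? meets? xs))
          where
          open Chosen C
          meets? : ∀ i → Dec (Any (span (basis i)) (points T))
          meets? i = Any.any? (span? (basis i)) (points T)
          -- At least one member is still missing, so r ≤ s - 1.
          r*j≤ : r ℕ.* suc j ≤ suc j ℕ.* s′
          r*j≤ = ℕₚ.≤-trans (ℕₚ.*-monoˡ-≤ (suc j) (subst (r ≤_) (ℕₚ.suc-injective eq) (ℕₚ.m≤n+m r f))) (ℕₚ.≤-reflexive (ℕₚ.*-comm s′ (suc j)))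
          meet⇒bound : All (λ i → Any (span (basis i)) (points T)) xs → length xs ≤ N ℕ.* [ suc j ℕ.* s′ ] q
          meet⇒bound meet = ℕₚ.≤-trans
            -- The members through a point p contain `p VF.∷ K`, which is independent and one
            -- dimension larger, so the bound for the next stage applies to them.
            (count-by (λ i p → span? (basis i) p) (points T) (λ p∈ ys! K⊑ys p∈ys →
              bound (indep-point indep p∈) ys! (All.zipWith (λ (p∈y , K⊑y) → λ { zero → p∈y ; (suc x) → K⊑y x }) (p∈ys , K⊑ys)))
              xs! K⊑xs meet)
            (ℕₚ.≤-trans (ℕₚ.*-monoˡ-≤ N (ℕₚ.≤-trans (ℕₚ.≤-reflexive (length-points T)) ([]-mono q r*j≤))) (ℕₚ.≤-reflexive (ℕₚ.*-comm _ N)))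
          ¬meet⇒bound : ¬ All (λ i → Any (span (basis i)) (points T)) xs → length xs ≤ N ℕ.* [ suc j ℕ.* s′ ] q
          ¬meet⇒bound ¬meet = let i , i∈xs , ¬meetᵢ = find (Allₚ.¬All⇒Any¬ meets? xs ¬meet) in
            greedy f (trans (ℕₚ.+-suc f r) eq) (chooseNext C (All.lookup K⊑xs i∈xs) ¬meetᵢ)

    -- Induction on `j` = k - d. For `j` = 0 all listed members coincide with span `K`, so
    -- distinctness leaves at most one.
    bound : ∀ j {d} {K : Vector (𝕍 n) d} → Indep K → d ℕ.+ j ≡ k → ∀ {xs} → Unique xs → All (K ⊑_) xs → length xs ≤ prodBound q s j
    bound zero    K-indep eq {[]}         xs! K⊑xs = z≤n
    bound zero    K-indep eq {_ ∷ []}     xs! K⊑xs = s≤s z≤n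
    bound zero {d} {K} K-indep eq {i ∷ i′ ∷ _} ((i≢i′ ∷ _) ∷ _) (K⊑i ∷ K⊑i′ ∷ _) = ⊥-elim (proj₂ family i i′ i≢i′
      λ v → (λ v∈ → from (span-mono K⊑i′ (⊆K K⊑i (to v∈)))) , λ v∈ → from (span-mono K⊑i (⊆K K⊑i′ (to v∈))))
      where
      ⊆K : ∀ {i} → K ⊑ i → ∀ {v} → span (basis i) v → span K v
      ⊆K {i} K⊑i = spans-if-dim {b = basis i} K-indep K⊑i (ℕₚ.≤-reflexive (trans (sym eq) (ℕₚ.+-identityʳ d)))
    bound (suc j) {d} {K} K-indep eq xs! K⊑xs =
      Step.greedy K-indep eq xs! K⊑xs (λ pK-indep → bound j pK-indep (trans (sym (ℕₚ.+-suc d j)) eq)) s (ℕₚ.+-identityʳ s) (Step.chosen₀ K-indep eq)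

    upperBound : m ≤ prodBound q s k
    upperBound = subst (_≤ prodBound q s k) (Listₚ.length-tabulate {n = m} id)
      -- The induction starts from the zero space, with empty basis, which every member contains.
      (bound k {K = λ ()} (λ _ _ ()) refl (Uniqueₚ.allFin⁺ m) (All.universal (λ _ ()) (allFin m)))

-- Lower bounds: linear conditions and the size of their solution space

module LowerBound {q} (𝔽 : FiniteField q) where
  open LinearAlgebra 𝔽
  open ≡-Reasoning

  IsLinear : ∀ {N} → (𝕍 N → F) → Set
  IsLinear φ = ∀ u c v → φ (u +ᵛ c *ᵛ v) ≡ φ u + c * φ v

  lookup-linear : ∀ {N} (x : Fin N) → IsLinear (λ v → lookup v x)
  lookup-linear x u c v = trans (lookup-+ᵛ u (c *ᵛ v) x) (cong (lookup u x +_) (lookup-*ᵛ c v x))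

  sum-linear : ∀ {N d} {φ : Fin d → 𝕍 N → F} → (∀ i → IsLinear (φ i)) → IsLinear (λ v → sum (λ i → φ i v))
  sum-linear {φ = φ} φ-linear u c v = begin
    sum (λ i → φ i (u +ᵛ c *ᵛ v))                  ≡⟨ sum-cong (λ i → φ-linear i u c v) ⟩
    sum (λ i → φ i u + c * φ i v)                  ≡⟨ sum-+ _ _ ⟩
    sum (λ i → φ i u) + sum (λ i → c * φ i v)      ≡⟨ cong (sum (λ i → φ i u) +_) (*-distribˡ-sum c _) ⟨
    sum (λ i → φ i u) + c * sum (λ i → φ i v)      ∎

  scale-linear : ∀ {N} {φ : 𝕍 N → F} a → IsLinear φ → IsLinear (λ v → a * φ v)
  scale-linear {φ = φ} a φ-linear u c v = begin
    a * φ (u +ᵛ c *ᵛ v)          ≡⟨ cong (a *_) (φ-linear u c v) ⟩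
    a * (φ u + c * φ v)          ≡⟨ distribˡ a _ _ ⟩
    a * φ u + a * (c * φ v)      ≡⟨ cong (a * φ u +_) (x*yz≡y*xz a c (φ v)) ⟩
    a * φ u + c * (a * φ v)      ∎

  module Kernel {N E} (φ : Fin E → 𝕍 N → F) (φ-linear : ∀ e → IsLinear (φ e)) where

    kernel? : ∀ v → Dec (∀ e → φ e v ≡ 0#)
    kernel? v = Finₚ.all? (λ e → φ e v ≟F 0#)

    kernel : List (𝕍 N)
    kernel = filter kernel? (allVecs N)

    kernel-unique : Unique kernel
    kernel-unique = Uniqueₚ.filter⁺ kernel? (allVecs-unique N)

    kernel-zero : ∀ i e → φ e (List.lookup kernel i) ≡ 0#
    kernel-zero i = All.lookup (Allₚ.all-filter kernel? (allVecs N)) (∈ₚ.∈-lookup i)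

    -- Every fibre of φ translates into the kernel.
    fibre-≤ : ∀ {c : 𝕍 E} {xs} → Unique xs → All (λ v → ∀ e → φ e v ≡ lookup c e) xs → length xs ≤ length kernel
    fibre-≤ {xs = []}         _   _      = z≤n
    fibre-≤ {c} {xs = x ∷ xs} xs! φxs = subst (_≤ length kernel) (Listₚ.length-map translate (x ∷ xs))
      (unique-⊆⇒≤ (Uniqueₚ.map⁺ translate-injective xs!) ∈kernel)
      where
      translate : 𝕍 N → 𝕍 N
      translate v = v +ᵛ (-ᵛ x)
      translate-injective : ∀ {u v} → translate u ≡ translate v → u ≡ v
      translate-injective {u} {v} eq = trans (sym (u-v+v≡u u x)) (trans (cong (_+ᵛ x) eq) (u-v+v≡u v x))
      φ-translate : ∀ {v} → v ∈ x ∷ xs → ∀ e → φ e (translate v) ≡ 0#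
      φ-translate {v} v∈ e = begin
        φ e (v +ᵛ (-ᵛ x))          ≡⟨ φ-linear e v (- 1#) x ⟩
        φ e v + - 1# * φ e x       ≡⟨ cong₂ _+_ (All.lookup φxs v∈ e) (trans (cong (- 1# *_) (All.lookup φxs (here refl) e)) (-1*x≈-x _)) ⟩
        lookup c e + - lookup c e  ≡⟨ -‿inverseʳ _ ⟩
        0#                         ∎
      ∈kernel : ∀ {y} → y ∈ List.map translate (x ∷ xs) → y ∈ kernel
      ∈kernel y∈ with v , v∈ , refl ← ∈ₚ.∈-map⁻ translate y∈ = ∈ₚ.∈-filter⁺ kernel? (∈-allVecs (translate v)) (φ-translate v∈)

    -- The counting form of rank-nullity: q^N vectors are distributed over q^E fibres, none larger
    -- than the kernel.
    kernel-size : q ℕ.^ N ≤ q ℕ.^ E ℕ.* length kernel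
    kernel-size = subst₂ (λ a b → a ≤ b ℕ.* length kernel) (length-allVecs N) (length-allVecs E)
      (count-by {P = λ _ → ⊤} (λ v c → Finₚ.all? (λ e → φ e v ≟F lookup c e)) (allVecs E)
        (λ {c} _ xs! _ φxs → fibre-≤ {c} xs! φxs)
        (allVecs-unique N) (All.universal (λ _ → tt) (allVecs N))
        (All.universal (λ v → lose (∈-allVecs (tabulate (λ e → φ e v))) (λ e → sym (Vecₚ.lookup∘tabulate _ e))) (allVecs N)))

  -- F^(k(1+t)) is read as pairs (a , m) with a ∈ F^k, a_j = at · j 0, and m ∈ (F^t)^k, m_jσ = at · j (1+σ).

  at : ∀ {k t} → 𝕍 (k ℕ.* t) → Fin k → Fin t → F
  at {k} w j τ = lookup w (combine {k} j τ)

  build : ∀ {k t} → (Fin k → Fin t → F) → 𝕍 (k ℕ.* t)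
  build {k} {t} g = tabulate (λ z → uncurry g (remQuot {k} t z))

  at-build : ∀ {k t} (g : Fin k → Fin t → F) j τ → at (build g) j τ ≡ g j τ
  at-build g j τ = trans (Vecₚ.lookup∘tabulate _ (combine j τ)) (cong (uncurry g) (Finₚ.remQuot-combine j τ))

  at-ext : ∀ {k t} {u v : 𝕍 (k ℕ.* t)} → (∀ j τ → at {k} u j τ ≡ at {k} v j τ) → u ≡ v
  at-ext {k} {t} {u} {v} eq = vec-ext λ x → let j , τ , p = Finₚ.combine-surjective {k} {t} x in
    subst (λ x → lookup u x ≡ lookup v x) p (eq j τ)

  at-0ᵛ : ∀ {k t} j τ → at {k} {t} 0ᵛ j τ ≡ 0#
  at-0ᵛ {k} j τ = lookup-0ᵛ (combine {k} j τ)

  at-lin : ∀ {k t d} (c : Vector F d) (b : Vector (𝕍 (k ℕ.* t)) d) j τ → at {k} (lin c b) j τ ≡ sum (λ i → c i * at {k} (b i) j τ)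
  at-lin {k} c b j τ = lookup-lin c b (combine {k} j τ)

  dot-build : ∀ {k t} (g : Fin k → Fin (suc t) → F) (w : 𝕍 (k ℕ.* suc t)) →
              dot (build g) w ≡ sum (λ j → g j zero * at {k} w j zero + sum (λ σ → g j (suc σ) * at {k} w j (suc σ)))
  dot-build {k} {t} g w = begin
    sum (λ x → lookup (build g) x * lookup w x)                                               ≡⟨ sum-combine k _ ⟩
    sum (λ j → sum (λ τ → at (build g) j τ * at {k} w j τ))                                   ≡⟨ sum-cong (λ j → sum-cong (λ τ → cong (_* at {k} w j τ) (at-build g j τ))) ⟩
    sum (λ j → sum (λ τ → g j τ * at {k} w j τ))                                              ≡⟨ sum-cong (λ j → sum-∷ _) ⟩
    sum (λ j → g j zero * at {k} w j zero + sum (λ σ → g j (suc σ) * at {k} w j (suc σ)))     ∎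

  indep-unit : ∀ {n} → Indep (unit {n})
  indep-unit c eq x = begin
    c x                                     ≡⟨ sum-δʳ x c ⟨
    sum (λ i → c i * δ i x)                 ≡⟨ sum-cong (λ i → cong (c i *_) (Vecₚ.lookup∘tabulate (δ i) x)) ⟨
    sum (λ i → c i * lookup (unit i) x)     ≡⟨ lookup-lin c unit x ⟨
    lookup (lin c unit) x                   ≡⟨ cong (λ v → lookup v x) eq ⟩
    lookup 0ᵛ x                             ≡⟨ lookup-0ᵛ x ⟩
    0#                                      ∎

  -- Lower bounds: graphs of constrained symmetric matrices

  module Construction {t k r} (ρ : Fin k → Fin r) (σ : Fin k → Fin t) (ρσ-injective : ∀ {i j} → ρ i ≡ ρ j → σ i ≡ σ j → i ≡ j) where

    dim : ℕ
    dim = k ℕ.* suc t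

    entry : 𝕍 (tri k ℕ.* t) → Fin k → Fin k → Fin t → F
    entry M i j = at M (triIndex i j)

    entry-sym : ∀ M i j τ → entry M i j τ ≡ entry M j i τ
    entry-sym M i j τ = cong (λ x → at M x τ) (triIndex-sym i j)

    entry-ext : ∀ {M M′} → (∀ i j τ → entry M i j τ ≡ entry M′ i j τ) → M ≡ M′
    entry-ext {M} {M′} eq = at-ext {tri k} λ x τ → let i , j , p = triIndex-surjective {k} x in
      subst (λ x → at {tri k} M x τ ≡ at {tri k} M′ x τ) p (eq i j τ)

    -- The coefficient of (m_j)_τ in the additional functional of class R, an indicator of (ρ j , σ
    -- j) = (R , τ).
    marked : Fin r → Fin k → Fin t → F
    marked R j τ = δ (ρ j) R * δ (σ j) τ

    -- Within the class of `i`, only `i` itself is marked at position σ i, by injectivity.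
    -- Restricted to that position, the additional functional is therefore the unit vector e_i.
    marked-unique : ∀ i j → marked (ρ i) j (σ i) ≡ δ i j
    marked-unique i j with i Fin.≟ j
    ... | yes refl = trans (cong₂ _*_ (δ-refl (ρ i)) (δ-refl (σ i))) (trans (*-identityˡ 1#) (sym (δ-refl i)))
    ... | no i≢j with ρ j Fin.≟ ρ i
    ...   | no ρ≢ = trans (trans (cong (_* δ (σ j) (σ i)) (δ-≢ ρ≢)) (zeroˡ _)) (sym (δ-≢ i≢j))
    ...   | yes ρ≡ = trans (trans (cong (δ (ρ j) (ρ i) *_) (δ-≢ (λ σ≡ → i≢j (sym (ρσ-injective ρ≡ σ≡))))) (zeroʳ _)) (sym (δ-≢ i≢j))

    constraint : Fin k → Fin r → 𝕍 (tri k ℕ.* t) → F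
    constraint i R M = sum (λ j → sum (λ τ → marked R j τ * entry M i j τ))

    constraint-linear : ∀ i R → IsLinear (constraint i R)
    constraint-linear i R = sum-linear {φ = λ j M → sum (λ τ → marked R j τ * entry M i j τ)}
      λ j → sum-linear {φ = λ τ M → marked R j τ * entry M i j τ}
      λ τ → scale-linear {φ = λ M → entry M i j τ} (marked R j τ) (lookup-linear (combine (triIndex i j) τ))

    -- The block matrix (I | M), whose rows form a basis of the graph U_M.
    cell : 𝕍 (tri k ℕ.* t) → Fin k → Fin k → Fin (suc t) → F
    cell M i j zero    = δ i j
    cell M i j (suc τ) = entry M i j τ

    row : 𝕍 (tri k ℕ.* t) → Vector (𝕍 dim) k
    row M i = build (cell M i)

    at₀-lin-row : ∀ M (c : Vector F k) j → at {k} (lin c (row M)) j zero ≡ c j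
    at₀-lin-row M c j = trans (at-lin c (row M) j zero) (trans (sum-cong (λ i → cong (c i *_) (at-build (cell M i) j zero))) (sum-δʳ j c))

    at₊-lin-row : ∀ M (c : Vector F k) j τ → at {k} (lin c (row M)) j (suc τ) ≡ sum (λ i → c i * entry M i j τ)
    at₊-lin-row M c j τ = trans (at-lin c (row M) j (suc τ)) (sum-cong (λ i → cong (c i *_) (at-build (cell M i) j (suc τ))))

    row-indep : ∀ M → Indep (row M)
    row-indep M c eq j = trans (sym (at₀-lin-row M c j)) (trans (cong (λ v → at {k} v j zero) eq) (at-0ᵛ {k} {suc t} j zero))

    -- The identity block returns the coefficients of a combination of rows, so the second component
    -- of a vector of U_M is its first component times M.
    span-row : ∀ {M w} → span (row M) w → ∀ j τ → at {k} w j (suc τ) ≡ sum (λ i → at {k} w i zero * entry M i j τ)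
    span-row {M} (c , refl) j τ = trans (at₊-lin-row M c j τ) (sum-cong (λ i → cong (_* entry M i j τ) (sym (at₀-lin-row M c i))))

    -- The only vector of U_M′ above e_i has second component e_i M′, so the rows of M and M′ agree.
    row-span-injective : ∀ {M M′} → (∀ i → span (row M′) (row M i)) → M ≡ M′
    row-span-injective {M} {M′} M⊆M′ = entry-ext λ i j τ → begin
      entry M i j τ                                              ≡⟨ at-build (cell M i) j (suc τ) ⟨
      at (row M i) j (suc τ)                                     ≡⟨ span-row (M⊆M′ i) j τ ⟩
      sum (λ l → at (row M i) l zero * entry M′ l j τ)           ≡⟨ sum-cong (λ l → cong (_* entry M′ l j τ) (at-build (cell M i) l zero)) ⟩
      sum (λ l → δ i l * entry M′ l j τ)                         ≡⟨ sum-δ i _ ⟩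
      entry M′ i j τ                                             ∎

    span-row-zero : ∀ {M w} → span (row M) w → (∀ j → at {k} w j zero ≡ 0#) → w ≡ 0ᵛ
    span-row-zero {M} {w} w∈ w₀≡0 = at-ext {k} λ
      { j zero    → trans (w₀≡0 j) (sym (at-0ᵛ {k} {suc t} j zero))
      ; j (suc τ) → trans (span-row w∈ j τ) (trans (sum-zero (λ i → trans (cong (_* entry M i j τ) (w₀≡0 i)) (zeroˡ _))) (sym (at-0ᵛ {k} {suc t} j (suc τ)))) }

    -- For w = (u , y), the functional (a , m) ↦ Σ_j u_j m_jτ − Σ_j a_j y_jτ.
    pairing : 𝕍 dim → Fin t → Fin k → Fin (suc t) → F
    pairing w τ j zero     = - at {k} w j (suc τ)
    pairing w τ j (suc τ′) = δ τ τ′ * at {k} w j zero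

    -- This is where the symmetry of M enters: on row i the functional has the value Σ_j u_j M_ij -
    -- y_i, while y = u M gives y_i = Σ_j u_j M_ji.
    pairing-row : ∀ {M w} → span (row M) w → ∀ τ i → dot (build (pairing w τ)) (row M i) ≡ 0#
    pairing-row {M} {w} w∈ τ i = begin
      dot (build (pairing w τ)) (row M i)
        ≡⟨ dot-build (pairing w τ) (row M i) ⟩
      sum (λ j → - at {k} w j (suc τ) * at (row M i) j zero + sum (λ τ′ → δ τ τ′ * at {k} w j zero * at (row M i) j (suc τ′)))
        ≡⟨ sum-cong (λ j → cong₂ _+_
             (cong (- at {k} w j (suc τ) *_) (trans (at-build (cell M i) j zero) (δ-sym i j)))
             (trans (sum-cong (λ τ′ → trans (*-assoc _ _ _) (cong (λ x → δ τ τ′ * (at {k} w j zero * x)) (at-build (cell M i) j (suc τ′))))) (sum-δ τ _))) ⟩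
      sum (λ j → - at {k} w j (suc τ) * δ j i + at {k} w j zero * entry M i j τ)
        ≡⟨ sum-+ _ _ ⟩
      sum (λ j → - at {k} w j (suc τ) * δ j i) + sum (λ j → at {k} w j zero * entry M i j τ)
        ≡⟨ cong₂ _+_ (sum-δʳ i (λ j → - at {k} w j (suc τ))) (sum-cong (λ j → cong (at {k} w j zero *_) (entry-sym M i j τ))) ⟩
      - at {k} w i (suc τ) + sum (λ j → at {k} w j zero * entry M j i τ)
        ≡⟨ cong (- at {k} w i (suc τ) +_) (span-row w∈ i τ) ⟨
      - at {k} w i (suc τ) + at {k} w i (suc τ)
        ≡⟨ -‿inverseˡ _ ⟩
      0# ∎

    mark : Fin r → Fin k → Fin (suc t) → F
    mark R j zero    = 0#
    mark R j (suc τ) = marked R j τ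

    mark-row : ∀ {M R} i → constraint i R M ≡ 0# → dot (build (mark R)) (row M i) ≡ 0#
    mark-row {M} {R} i Mi≡0 = begin
      dot (build (mark R)) (row M i)
        ≡⟨ dot-build (mark R) (row M i) ⟩
      sum (λ j → 0# * at (row M i) j zero + sum (λ τ → marked R j τ * at (row M i) j (suc τ)))
        ≡⟨ sum-cong (λ j → trans (cong₂ _+_ (zeroˡ _) (sum-cong (λ τ → cong (marked R j τ *_) (at-build (cell M i) j (suc τ))))) (+-identityˡ _)) ⟩
      constraint i R M
        ≡⟨ Mi≡0 ⟩
      0# ∎

    module Kernels {d} (κ : Vector (𝕍 dim) d) where

      head₀ : Vector (𝕍 k) d
      head₀ x = tabulate (λ j → at {k} (κ x) j zero)

      lookup-lin-head₀ : ∀ c j → lookup (lin c head₀) j ≡ sum (λ x → c x * at {k} (κ x) j zero)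
      lookup-lin-head₀ c j = trans (lookup-lin c head₀ j) (sum-cong (λ x → cong (c x *_) (Vecₚ.lookup∘tabulate _ j)))

      -- The projection to F^k is injective on the graph U_M, which contains `κ`.
      head₀-indep : ∀ {M} → Indep κ → (∀ x → span (row M) (κ x)) → Indep head₀
      head₀-indep {M} κ-indep κ⊆M c eq = κ-indep c (span-row-zero {M} (span-lin (row M) c κ⊆M) λ j → begin
        at {k} (lin c κ) j zero                     ≡⟨ at-lin c κ j zero ⟩
        sum (λ x → c x * at {k} (κ x) j zero)       ≡⟨ lookup-lin-head₀ c j ⟨
        lookup (lin c head₀) j                      ≡⟨ cong (λ v → lookup v j) eq ⟩
        lookup 0ᵛ j                                 ≡⟨ lookup-0ᵛ j ⟩
        0#                                          ∎)

      outside : d < k → ∃[ j ] ¬ span head₀ (unit j)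
      outside d<k = Finₚ.¬∀⟶∃¬ _ _ (λ j → span? head₀ (unit j)) (λ unit⊆ → ℕₚ.<⇒≱ d<k (indep-≤ indep-unit unit⊆))

      -- The additional functional of class R comes first; then follows one pairing for each basis
      -- vector of the kernel and each of the t components.
      functionals : Fin r → Vector (𝕍 dim) (suc (d ℕ.* t))
      functionals R = build (mark R) VF.∷ λ z → build (pairing (κ (proj₁ (remQuot {d} t z))) (proj₂ (remQuot {d} t z)))

      -- At the coordinates (m_j)_τ with τ fixed, a vanishing combination is a relation between the
      -- marked vector and the projections of `κ`. For τ = σ j₀ the marked vector is e_{j₀}, outside
      -- their span, so its coefficient is 0; afterwards independence of the projections handles
      -- every τ.
      functionals-indep : Indep head₀ → ∀ j₀ → ¬ span head₀ (unit j₀) → Indep (functionals (ρ j₀))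
      functionals-indep h-indep j₀ j₀∉ c eq = λ { zero → c₀≡0 ; (suc z) → subst (λ z → c (suc z) ≡ 0#) (Finₚ.combine-remQuot {d} t z) (c₊≡0 _ _) }
        where
        C : Fin d → Fin t → F
        C x τ = c (suc (combine x τ))
        coordinate : ∀ j τ → c zero * marked (ρ j₀) j τ + sum (λ x → C x τ * at {k} (κ x) j zero) ≡ 0#
        coordinate j τ = begin
          c zero * marked (ρ j₀) j τ + sum (λ x → C x τ * at {k} (κ x) j zero)
            ≡⟨ cong₂ (λ a b → c zero * a + b) (at-build (mark (ρ j₀)) j (suc τ)) (sum-cong λ x → sum-δʳ τ (λ τ′ → C x τ′ * at {k} (κ x) j zero)) ⟨
          c zero * at {k} f₀ j (suc τ) + sum (λ x → sum (λ τ′ → C x τ′ * at {k} (κ x) j zero * δ τ′ τ))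
            ≡⟨ cong (c zero * at {k} f₀ j (suc τ) +_) (sum-cong λ x → sum-cong λ τ′ → pair x τ′) ⟨
          c zero * at {k} f₀ j (suc τ) + sum (λ x → sum (λ τ′ → C x τ′ * at {k} (functionals (ρ j₀) (suc (combine x τ′))) j (suc τ)))
            ≡⟨ cong (c zero * at {k} f₀ j (suc τ) +_) (sum-combine d (λ z → c (suc z) * at {k} (functionals (ρ j₀) (suc z)) j (suc τ))) ⟨
          c zero * at {k} f₀ j (suc τ) + sum (λ z → c (suc z) * at {k} (functionals (ρ j₀) (suc z)) j (suc τ))
            ≡⟨ sum-∷ _ ⟨
          sum (λ z → c z * at {k} (functionals (ρ j₀) z) j (suc τ))
            ≡⟨ at-lin c (functionals (ρ j₀)) j (suc τ) ⟨
          at {k} (lin c (functionals (ρ j₀))) j (suc τ)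
            ≡⟨ cong (λ v → at {k} v j (suc τ)) eq ⟩
          at {k} {suc t} 0ᵛ j (suc τ)
            ≡⟨ at-0ᵛ {k} {suc t} j (suc τ) ⟩
          0# ∎
          where
          f₀ : 𝕍 dim
          f₀ = build (mark (ρ j₀))
          pair : ∀ x τ′ → C x τ′ * at {k} (functionals (ρ j₀) (suc (combine x τ′))) j (suc τ) ≡ C x τ′ * at {k} (κ x) j zero * δ τ′ τ
          pair x τ′ = begin
            C x τ′ * at {k} (functionals (ρ j₀) (suc (combine x τ′))) j (suc τ)
              ≡⟨ cong (λ (y , τ″) → C x τ′ * at {k} (build (pairing (κ y) τ″)) j (suc τ)) (Finₚ.remQuot-combine x τ′) ⟩
            C x τ′ * at {k} (build (pairing (κ x) τ′)) j (suc τ)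
              ≡⟨ cong (C x τ′ *_) (trans (at-build (pairing (κ x) τ′) j (suc τ)) (*-comm (δ τ′ τ) _)) ⟩
            C x τ′ * (at {k} (κ x) j zero * δ τ′ τ)
              ≡⟨ *-assoc _ _ _ ⟨
            C x τ′ * at {k} (κ x) j zero * δ τ′ τ ∎
        c₀≡0 : c zero ≡ 0#
        c₀≡0 = indep-∷ h-indep j₀∉ (c zero VF.∷ λ x → C x (σ j₀)) (vec-ext λ j → begin
          lookup (c zero *ᵛ unit j₀ +ᵛ lin (λ x → C x (σ j₀)) head₀) j
            ≡⟨ lookup-+ᵛ (c zero *ᵛ unit j₀) _ j ⟩
          lookup (c zero *ᵛ unit j₀) j + lookup (lin (λ x → C x (σ j₀)) head₀) j
            ≡⟨ cong₂ _+_ (trans (lookup-*ᵛ (c zero) (unit j₀) j) (cong (c zero *_) (trans (Vecₚ.lookup∘tabulate (δ j₀) j) (sym (marked-unique j₀ j)))))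
                 (lookup-lin-head₀ (λ x → C x (σ j₀)) j) ⟩
          c zero * marked (ρ j₀) j (σ j₀) + sum (λ x → C x (σ j₀) * at {k} (κ x) j zero)
            ≡⟨ coordinate j (σ j₀) ⟩
          0#
            ≡⟨ lookup-0ᵛ j ⟨
          lookup 0ᵛ j ∎) zero
        c₊≡0 : ∀ x τ → C x τ ≡ 0#
        c₊≡0 x τ = h-indep (λ x → C x τ) (vec-ext λ j → begin
          lookup (lin (λ x → C x τ) head₀) j
            ≡⟨ lookup-lin-head₀ (λ x → C x τ) j ⟩
          sum (λ x → C x τ * at {k} (κ x) j zero)
            ≡⟨ +-identityˡ _ ⟨
          0# + sum (λ x → C x τ * at {k} (κ x) j zero)
            ≡⟨ cong (_+ sum (λ x → C x τ * at {k} (κ x) j zero)) (trans (cong (_* marked (ρ j₀) j τ) c₀≡0) (zeroˡ _)) ⟨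
          c zero * marked (ρ j₀) j τ + sum (λ x → C x τ * at {k} (κ x) j zero)
            ≡⟨ coordinate j τ ⟩
          0#
            ≡⟨ lookup-0ᵛ j ⟨
          lookup 0ᵛ j ∎) x

      -- All the functionals vanish on every row of every `M i`: the first by the constraints, the
      -- others because `κ` lies in each graph. They thus annihilate the whole sum.
      sum-dim : ∀ {s D} {M : Fin (suc s) → 𝕍 (tri k ℕ.* t)} → (∀ i R l → constraint l R (M i) ≡ 0#) →
                Indep κ → (∀ i x → span (row (M i)) (κ x)) → d < k →
                {β : Vector (𝕍 dim) D} → Indep β → (∀ e → SumOf 𝔽 (suc s) (λ i → span (row (M i))) (β e)) → D ℕ.+ suc (d ℕ.* t) ≤ dim
      sum-dim {s} {D} {M} M≡0 κ-indep κ⊆M d<k {β} β-indep β∈ =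
        annihilator-dim β (functionals (ρ j₀)) β-indep (functionals-indep (head₀-indep {M zero} κ-indep (κ⊆M zero)) j₀ (proj₂ (outside d<k))) vanish
        where
        j₀ : Fin k
        j₀ = proj₁ (outside d<k)
        vanish-row : ∀ z i l → dot (functionals (ρ j₀) z) (row (M i) l) ≡ 0#
        vanish-row zero    i l = mark-row {M i} l (M≡0 i (ρ j₀) l)
        vanish-row (suc z) i l = pairing-row {M i} (κ⊆M i _) _ l
        vanish : ∀ z e → dot (functionals (ρ j₀) z) (β e) ≡ 0#
        vanish z e = let w , w∈ , eq = β∈ e in
          trans (cong (dot (functionals (ρ j₀) z)) eq) (dot-vsum≡0 (functionals (ρ j₀) z) {w} (λ i → dot-span≡0 (functionals (ρ j₀) z) (vanish-row z i) (w∈ i)))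

    constraints : Fin (k ℕ.* r) → 𝕍 (tri k ℕ.* t) → F
    constraints z = uncurry constraint (remQuot {k} r z)

    open Kernel constraints (λ z → constraint-linear _ _)

    size : ℕ
    size = length kernel

    matrix : Fin size → 𝕍 (tri k ℕ.* t)
    matrix = List.lookup kernel

    matrix-constraint : ∀ i R l → constraint l R (matrix i) ≡ 0#
    matrix-constraint i R l = subst (λ p → uncurry constraint p (matrix i) ≡ 0#) (Finₚ.remQuot-combine l R) (kernel-zero i (combine l R))

    spaces : Fin size → Pred 𝔽 dim
    spaces i = span (row (matrix i))

    spaces-family : IsFamilyOfKSpaces 𝔽 k spaces
    spaces-family =
      (λ i → row (matrix i) , row-indep (matrix i) , λ v → id , id) ,
      (λ i j i≢j eq → i≢j (unique⇒lookup-injective kernel-unique i j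
        (row-span-injective (λ l → proj₁ (eq (row (matrix i) l)) (span-generator (row (matrix i)) l)))))

    -- The sum of a sunflower would have dimension d + s (k - d), which `sum-dim` forbids by a
    -- margin of one.
    spaces-free : 1 ≤ t → SunflowerFree 𝔽 (suc t) k spaces
    spaces-free (s≤s {n = t′} _) ι ι-injective (_ , distinct , d , K , (κ , κ-indep , K≐κ) , kernel-∩ , (β , β-indep , sum≐β)) =
      ℕₚ.<⇒≱ dim<  (Kernels.sum-dim κ (λ i → matrix-constraint (ι i)) κ-indep κ⊆ d<k β-indep
        (λ e → proj₂ (sum≐β (β e)) (span-generator β e)))
      where
      -- The kernel is given as an intersection of two different members, so a second index is
      -- required; t ≥ 1 supplies it.
      κ⊆ : ∀ i x → span (row (matrix (ι i))) (κ x)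
      κ⊆ i x = let i′ , i≢i′ = another i in proj₁ (proj₁ (kernel-∩ i i′ i≢i′ (κ x)) (proj₂ (K≐κ (κ x)) (span-generator κ x)))
        where
        another : ∀ {n} (i : Fin (suc (suc n))) → ∃[ j ] i ≢ j
        another zero    = suc zero , λ ()
        another (suc i) = zero , λ ()
      -- A kernel of dimension at least k would fill two distinct members and make them equal.
      d<k : d < k
      d<k = ℕₚ.≰⇒> λ k≤d → distinct zero (suc zero) (λ ()) λ v →
        (λ v∈ → span-mono (κ⊆ (suc zero)) (spans-if-dim κ-indep (κ⊆ zero) k≤d v∈)) ,
        (λ v∈ → span-mono (κ⊆ zero) (spans-if-dim κ-indep (κ⊆ (suc zero)) k≤d v∈))
      dim< : dim < d ℕ.+ suc t ℕ.* (k ℕ.∸ d) ℕ.+ suc (d ℕ.* t)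
      dim< = ℕₚ.≤-reflexive (sunflower-dim t (ℕₚ.<⇒≤ d<k))

  -- There are q^(t C(k + 1, 2)) symmetric matrices, and the k r conditions cost a factor of at most
  -- q^(k r).
  large-family : ∀ {t k r X} → 1 ≤ t → 1 ≤ k → k ≤ r ℕ.* t → k ℕ.* r ℕ.+ X ≤ t ℕ.* tri k →
                 ∃[ n ] ∃[ m ] ∃[ 𝓕 ] (1 ≤ n × IsFamilyOfKSpaces 𝔽 {n} {m} k 𝓕 × SunflowerFree 𝔽 (suc t) k 𝓕 × q ℕ.^ X ≤ m)
  large-family {t} {k} {r} {X} 1≤t 1≤k k≤rt k*r+X≤ =
    dim , size , spaces , ℕₚ.*-mono-≤ 1≤k (s≤s z≤n) , spaces-family , spaces-free 1≤t , q^X≤size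
    where
    -- The k indices fill an r × t grid row by row.
    position : Fin k → Fin r × Fin t
    position j = remQuot {r} t (Fin.inject≤ j k≤rt)
    position-injective : ∀ {i j} → proj₁ (position i) ≡ proj₁ (position j) → proj₂ (position i) ≡ proj₂ (position j) → i ≡ j
    position-injective {i} {j} eq eq′ = Finₚ.inject≤-injective k≤rt k≤rt i j
      (trans (sym (Finₚ.combine-remQuot {r} t _)) (trans (cong₂ combine eq eq′) (Finₚ.combine-remQuot {r} t _)))
    open Construction (proj₁ ∘ position) (proj₂ ∘ position) position-injective
    q^X≤size : q ℕ.^ X ≤ size
    q^X≤size = ℕₚ.*-cancelˡ-≤ (q ℕ.^ (k ℕ.* r)) {{ℕₚ.m^n≢0 q (k ℕ.* r) {{ℕ.>-nonZero (ℕₚ.<⇒≤ 1<q)}}}} (ℕₚ.≤-trans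
      (ℕₚ.≤-reflexive (sym (ℕₚ.^-distribˡ-+-* q (k ℕ.* r) X)))
      (ℕₚ.≤-trans (ℕₚ.^-monoʳ-≤ q {{ℕ.>-nonZero (ℕₚ.<⇒≤ 1<q)}} (ℕₚ.≤-trans k*r+X≤ (ℕₚ.≤-reflexive (ℕₚ.*-comm t (tri k)))))
        (Kernel.kernel-size constraints (λ z → constraint-linear _ _))))

-- Assembly of the upper and lower bounds

open import Data.Nat using (_+_; _*_; _∸_; _^_; _≥_; _/_)
open import Data.Nat.Combinatorics using (_C_)

theorem1p3 : (s k q : ℕ) → s ≥ 3 → k ≥ 2 → IsPrimePower q → (𝔽 : FiniteField q) →
    ((n m : ℕ) → n ≥ 1 → (𝓕 : Fin m → Pred 𝔽 n) →
    IsFamilyOfKSpaces 𝔽 k 𝓕 → SunflowerFree 𝔽 s k 𝓕 →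
    (m ≤ prodBound q s k)
    × (prodBound q s k * (q ∸ 1) ^ k ≤ q ^ k * q ^ ((s ∸ 1) * (suc k C 2) ∸ k)))
    ×
    (s ≥ k + 1 →
    ∃[ n ] ∃[ m ] ∃[ 𝓕 ] (n ≥ 1 × IsFamilyOfKSpaces 𝔽 {n} {m} k 𝓕 × SunflowerFree 𝔽 s k 𝓕
    × m ≥ q ^ ((s ∸ 1) * (suc k C 2) ∸ k)))
    ×
    (s ≤ k →
    ∃[ n ] ∃[ m ] ∃[ 𝓕 ] (n ≥ 1 × IsFamilyOfKSpaces 𝔽 {n} {m} k 𝓕 × SunflowerFree 𝔽 s k 𝓕
    × m ≥ q ^ ((2 * ((s ∸ 2) * (suc k C 2)) + k * gcd k (s ∸ 1) ∸ 3 * k) / 2)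
    × q ^ ((2 * ((s ∸ 2) * (suc k C 2)) + k * gcd k (s ∸ 1) ∸ 3 * k) / 2)
    ≥ q ^ ((s ∸ 2) * (suc k C 2) ∸ k)))
theorem1p3 (suc (suc (suc u))) k q (s≤s (s≤s (s≤s z≤n))) k≥2 _ 𝔽 = upper , lower₁ , lower₂
  where
  open LinearAlgebra 𝔽 using (1<q)
  open LowerBound 𝔽 using (large-family)

  -- With s = u + 3, s - 1 is `t` and s - 2 is `suc u`.
  t : ℕ
  t = suc (suc u)

  k≥1 : k ≥ 1
  k≥1 = ℕₚ.<⇒≤ k≥2

  upper : (n m : ℕ) → n ≥ 1 → (𝓕 : Fin m → Pred 𝔽 n) → IsFamilyOfKSpaces 𝔽 k 𝓕 → SunflowerFree 𝔽 (suc t) k 𝓕 →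
          (m ≤ prodBound q (suc t) k) × (prodBound q (suc t) k * (q ∸ 1) ^ k ≤ q ^ k * q ^ (t * (suc k C 2) ∸ k))
  upper n m _ 𝓕 family free = UpperBound.Family.upperBound 𝔽 𝓕 family free , prodBound-upper q t k (ℕₚ.<⇒≤ 1<q) (s≤s z≤n)

  lower₁ : suc t ≥ k + 1 →
           ∃[ n ] ∃[ m ] ∃[ 𝓕 ] (n ≥ 1 × IsFamilyOfKSpaces 𝔽 {n} {m} k 𝓕 × SunflowerFree 𝔽 (suc t) k 𝓕
             × m ≥ q ^ (t * (suc k C 2) ∸ k))
  -- From k ≤ t a single row holds all indices, and r = 1 costs exactly the k subtracted in the
  -- exponent.
  lower₁ s≥k+1 = large-family {r = 1} (s≤s z≤n) k≥1
    (subst (k ≤_) (sym (ℕₚ.*-identityˡ t)) (ℕ.s≤s⁻¹ (subst (_≤ suc t) (ℕₚ.+-comm k 1) s≥k+1)))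
    (ℕₚ.≤-reflexive (trans (cong₂ (λ x y → x + (t * y ∸ k)) (ℕₚ.*-identityʳ k) (sym (tri≡C k)))
      (ℕₚ.m+[n∸m]≡n (ℕₚ.≤-trans (k≤tri k) (ℕₚ.m≤n*m (tri k) t)))))

  lower₂ : suc t ≤ k →
           ∃[ n ] ∃[ m ] ∃[ 𝓕 ] (n ≥ 1 × IsFamilyOfKSpaces 𝔽 {n} {m} k 𝓕 × SunflowerFree 𝔽 (suc t) k 𝓕
             × m ≥ q ^ ((2 * (suc u * (suc k C 2)) + k * gcd k t ∸ 3 * k) / 2)
             × q ^ ((2 * (suc u * (suc k C 2)) + k * gcd k t ∸ 3 * k) / 2) ≥ q ^ (suc u * (suc k C 2) ∸ k))
  lower₂ s≤k =
    -- The hypothesis s ≤ k is literally t < k, as `rows` requires.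
    let r , k≤r*t , 2r+g≤k+4 , g≥1 = rows t k (gcd k t) (s≤s (s≤s z≤n)) s≤k (gcd[m,n]∣n k t) (gcd[m,n]∣m k t)
        n , m , 𝓕 , n≥1 , family , free , m≥ =
          large-family {r = r} (s≤s z≤n) k≥1 k≤r*t (exponent-≤ (suc u) k r (gcd k t) k≥1 (s≤s (s≤s z≤n)) g≥1 2r+g≤k+4)
    in n , m , 𝓕 , n≥1 , family , free , m≥ ,
       ℕₚ.^-monoʳ-≤ q {{ℕ.>-nonZero (ℕₚ.<⇒≤ 1<q)}} (exponent-≥ (suc u * (suc k C 2)) k (gcd k t) g≥1)
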